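{- Let $d\ge 2$, let $D$ be a $d$-ary tree with at least two leaves, and let $D_1,D_2,\ldots,D_d$ be its branches (some of which might be empty). Let $m_j$ be the number of branches with $j$ leaves, for every $j\ge 0$. Then $$I_d(D)\le\frac{|M(D)|\prod_{j\ge 0}m_j!}{d!}\prod_{i=1}^d I_d(D_i).$$ If branches with the same number of leaves are isomorphic, then this reduces to $$I_d(D)\le\prod_{i=1}^d I_d(D_i).$$
   Context: A $d$-ary tree is a finite rooted tree in which every internal (non-leaf) vertex has at least two and at most $d$ children; a single vertex is a $d$-ary tree with one leaf, and the empty tree with $0$ leaves is also allowed. Isomorphism means root-preserving isomorphism (two empty trees are isomorphic). $\|T\|$ denotes the number of leaves of $T$. A set $S$ of leaves of $T$ induces a $d$-ary tree: take the smallest subtree of $T$ containing all leaves in $S$ (rooted at the most recent common ancestor of $S$) and repeatedly suppress every vertex with exactly one child (contracting its two adjacent edges to a single edge). $c(D,T)$ is the number of sets of $\|D\|$ leaves of $T$ that induce a tree isomorphic to $D$, and $\gamma(D,T)=c(D,T)/\binom{\|T\|}{\|D\|}$. The $d$-ary inducibility of a nonempty $d$-ary tree $D$ is $$I_d(D)=\limsup_{n\to\infty}\ \max_{\substack{\|T\|=n\\ T\ d\text{ -ary tree}}}\gamma(D,T),$$ and $I_d(D)=1$ if $D$ is empty. The branches of a $d$-ary tree $D$ with at least two leaves are the components (rooted at the children of the root) obtained on removing the root; the list is padded with empty trees to have exactly $d$ entries $D_1,\ldots,D_d$. On the set of permutations of $[d]=\{1,\ldots,d\}$ define $\pi\sim_D\pi'$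 if $D_{\pi(j)}$ is isomorphic to $D_{\pi'(j)}$ for every $j\in[d]$; $M(D)$ is a complete set of representatives of the equivalence classes of $\sim_D$. -}

module Defs where

open import Data.Fin.Base using (Fin)
open import Data.Fin.Permutation using (Permutation′; _⟨$⟩ʳ_)
open import Data.Fin.Properties using (any?)
open import Data.Fin.Subset using (Subset; inside; outside; ∣_∣)
open import Data.Integer.Base using (+_)
open import Data.List.Base as List
  using (List; []; _∷_; _++_; length; lookup; removeAt; filter; upTo)
open import Data.List.Relation.Unary.All using (All)
open import Data.List.Relation.Unary.AllPairs using (AllPairs)
open import Data.List.Relation.Unary.Any using (Any)
open import Data.Maybe.Base using (Maybe; just; nothing; maybe′)
open import Data.Maybe.Relation.Binary.Pointwise as Pointwise using (Pointwise)
open import Data.Nat.Base as ℕ using (ℕ; zero; suc; _+_; _!)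
open import Data.Nat.Combinatorics using (_C_)
open import Data.Nat.ListAction using (product)
import Data.Nat.Properties as ℕ
open import Data.Product.Base using (∃; _×_; _,_; proj₁)
open import Data.Rational.Base as ℚ using (ℚ; 0ℚ; 1ℚ; _<_; NonNegative; _/_)
import Data.Rational.Properties as ℚ
open import Data.Vec.Base as Vec using (Vec; []; _∷_)
open import Relation.Binary.Definitions using (Decidable)
open import Relation.Binary.PropositionalEquality using (_≡_)
open import Relation.Nullary using (¬_; yes; no; map′; _×-dec_)
import Relation.Unary as Unary

infix 4 _≅_ _≅*_ _≅?_ _≅*?_ _≅ᴹ_ _≅ᴹ?_ _≼_
infixl 7 _·_ _÷_

-- Extended non-negative reals [0,∞], presented by upper cuts: x is given by
-- the set of rationals strictly above it.  Classically these are exactly the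
-- elements of [0,∞] (∞ having the empty cut), with their usual order, infima,
-- suprema and, on finite elements, products.  Unlike Cauchy or two-sided
-- Dedekind reals, they have all suprema and infima constructively.

record ℝ⁺ : Set₁ where
  field
    Above    : ℚ → Set
    positive : ∀ {q} → Above q → 0ℚ < q
    upward   : ∀ {q r} → Above q → q < r → Above r
    rounded  : ∀ {q} → Above q → ∃ λ r → r < q × Above r

open ℝ⁺ public renaming (Above to _≺_)

_≼_ : ℝ⁺ → ℝ⁺ → Set
x ≼ y = ∀ q → y ≺ q → x ≺ q

fromℚ : (p : ℚ) → .{{NonNegative p}} → ℝ⁺
fromℚ p = record
  { Above     = λ q → p < q
  ; positive  = λ p<q → ℚ.≤-<-trans (ℚ.nonNegative⁻¹ p) p<q
  ; upward    = ℚ.<-trans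
  ; rounded   = λ p<q → let r , p<r , r<q = ℚ.<-dense p<q in r , r<q , p<r
  }

-- a ÷ b is the real number a/b, with the convention a ÷ 0 = 0.
_÷_ : ℕ → ℕ → ℝ⁺
a ÷ zero  = fromℚ 0ℚ
a ÷ suc b = fromℚ (+ a / suc b) {{ℚ.normalize-nonNeg a (suc b)}}

_·_ : ℝ⁺ → ℝ⁺ → ℝ⁺
x · y = record
  { Above     = λ q → ∃ λ a → ∃ λ b → x ≺ a × y ≺ b × a ℚ.* b < q
  ; positive  = λ { (a , b , x≺a , y≺b , ab<q) →
                    ℚ.<-trans (pos a b (positive x x≺a) (positive y y≺b)) ab<q }
  ; upward    = λ { (a , b , x≺a , y≺b , ab<q) q<r →
                    a , b , x≺a , y≺b , ℚ.<-trans ab<q q<r }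
  ; rounded   = λ { (a , b , x≺a , y≺b , ab<q) →
                    let r , ab<r , r<q = ℚ.<-dense ab<q
                    in r , r<q , (a , b , x≺a , y≺b , ab<r) }
  }
  where
  pos : ∀ a b → 0ℚ < a → 0ℚ < b → 0ℚ < a ℚ.* b
  pos a b 0<a 0<b =
    ℚ.positive⁻¹ (a ℚ.* b)
      {{ℚ.pos*pos⇒pos a {{ℚ.positive 0<a}} b {{ℚ.positive 0<b}}}}

∏ : ∀ {n} → Vec ℝ⁺ n → ℝ⁺
∏ = Vec.foldr (λ _ → ℝ⁺) _·_ (fromℚ 1ℚ)

-- The supremum is strictly below q iff the family is bounded by some r < q.
⨆ : {A : Set} → (A → ℝ⁺) → ℝ⁺
⨆ f = record
  { Above     = λ q → ∃ λ r → 0ℚ < r × r < q × (∀ i → f i ≺ r)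
  ; positive  = λ { (r , 0<r , r<q , _) → ℚ.<-trans 0<r r<q }
  ; upward    = λ { (r , 0<r , r<q , f≺r) q<s → r , 0<r , ℚ.<-trans r<q q<s , f≺r }
  ; rounded   = λ { (r , 0<r , r<q , f≺r) →
                    let s , r<s , s<q = ℚ.<-dense r<q
                    in s , s<q , (r , 0<r , r<s , f≺r) }
  }

⨅ : {A : Set} → (A → ℝ⁺) → ℝ⁺
⨅ f = record
  { Above     = λ q → ∃ λ i → f i ≺ q
  ; positive  = λ { (i , h) → positive (f i) h }
  ; upward    = λ { (i , h) q<r → i , upward (f i) h q<r }
  ; rounded   = λ { (i , h) → let r , r<q , h′ = rounded (f i) h in r , r<q , (i , h′) }
  }

limsup : (ℕ → ℝ⁺) → ℝ⁺
limsup x = ⨅ λ (N : ℕ) → ⨆ λ (n : ∃ λ n → N ℕ.≤ n) → x (proj₁ n)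

-- A nonempty finite rooted tree is its list of branches; a leaf is node [].
-- The order of the branches is disregarded by _≅_.
data Tree : Set where
  node : List Tree → Tree

-- Possibly empty trees, nothing being the empty tree.
Tree₀ : Set
Tree₀ = Maybe Tree

data IsDary (d : ℕ) : Tree → Set where
  leaf     : IsDary d (node [])
  internal : ∀ {ts} → 2 ℕ.≤ length ts → length ts ℕ.≤ d →
             All (IsDary d) ts → IsDary d (node ts)

mutual
  ‖_‖ : Tree → ℕ
  ‖ node [] ‖       = 1
  ‖ node (t ∷ ts) ‖ = ‖ t ∷ ts ‖*

  ‖_‖* : List Tree → ℕ
  ‖ [] ‖*     = 0
  ‖ t ∷ ts ‖* = ‖ t ‖ + ‖ ts ‖*

‖_‖₀ : Tree₀ → ℕ
‖_‖₀ = maybe′ ‖_‖ 0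

-- Root-preserving isomorphism: ts ≅* us says that the lists ts and us can be
-- matched bijectively into isomorphic pairs.
mutual
  data _≅_ : Tree → Tree → Set where
    iso : ∀ {ts us} → ts ≅* us → node ts ≅ node us

  data _≅*_ : List Tree → List Tree → Set where
    []    : [] ≅* []
    match : ∀ {t ts us} (i : Fin (length us)) →
            t ≅ lookup us i → ts ≅* removeAt us i → (t ∷ ts) ≅* us

_≅ᴹ_ : Tree₀ → Tree₀ → Set
_≅ᴹ_ = Pointwise _≅_

mutual
  _≅?_ : Decidable _≅_
  node ts ≅? node us = map′ iso (λ { (iso p) → p }) (ts ≅*? us)

  _≅*?_ : Decidable _≅*_
  []       ≅*? []       = yes []
  []       ≅*? (_ ∷ _)  = no λ ()
  (t ∷ ts) ≅*? us       =
    map′ (λ { (i , p , ps) → match i p ps })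
         (λ { (match i p ps) → i , p , ps })
         (any? λ i → (t ≅? lookup us i) ×-dec (ts ≅*? removeAt us i))

_≅ᴹ?_ : Decidable _≅ᴹ_
_≅ᴹ?_ = Pointwise.dec _≅?_

-- The tree hanging off a vertex v, given the nonempty trees induced in the
-- branches at v.  If there is just one, then v is either a strict ancestor of
-- the most recent common ancestor, or a vertex with one child that is
-- suppressed; in both cases v is dropped.
join : List Tree → Tree₀
join []              = nothing
join (t ∷ [])        = just t
join ts@(_ ∷ _ ∷ _)  = just (node ts)

-- The tree induced by a set of leaves, the leaves being numbered from left to
-- right.
mutual
  induced : (T : Tree) → Subset ‖ T ‖ → Tree₀
  induced (node [])       (inside  ∷ []) = just (node [])
  induced (node [])       (outside ∷ []) = nothing
  induced (node (t ∷ ts)) S              = join (induced* (t ∷ ts) S)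

  induced* : (ts : List Tree) → Subset ‖ ts ‖* → List Tree
  induced* []       S = []
  induced* (t ∷ ts) S =
    List.fromMaybe (induced t (Vec.take ‖ t ‖ S)) ++ induced* ts (Vec.drop ‖ t ‖ S)

subsets : ∀ n → List (Subset n)
subsets zero    = [] ∷ []
subsets (suc n) = List.map (inside ∷_) (subsets n) ++ List.map (outside ∷_) (subsets n)

InducesCopy : (D T : Tree) → Subset ‖ T ‖ → Set
InducesCopy D T S = ∣ S ∣ ≡ ‖ D ‖ × induced T S ≅ᴹ just D

inducesCopy? : ∀ D T → Unary.Decidable (InducesCopy D T)
inducesCopy? D T S = (∣ S ∣ ℕ.≟ ‖ D ‖) ×-dec (induced T S ≅ᴹ? just D)

c : Tree → Tree → ℕ
c D T = length (filter (inducesCopy? D T) (subsets ‖ T ‖))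

γ : Tree → Tree → ℝ⁺
γ D T = c D T ÷ (‖ T ‖ C ‖ D ‖)

-- For each n ≥ 1 the inner supremum is a maximum: up to isomorphism there are
-- only finitely many d-ary trees with n leaves.
I : ℕ → Tree₀ → ℝ⁺
I d nothing  = fromℚ 1ℚ
I d (just D) =
  limsup λ n → ⨆ λ (T : ∃ λ T → IsDary d T × ‖ T ‖ ≡ n) → γ D (proj₁ T)

-- Meaningful only for lists of length at most d, as longer ones are truncated.
pad : ∀ d → List Tree → Vec Tree₀ d
pad zero    _        = []
pad (suc d) []       = nothing ∷ pad d []
pad (suc d) (t ∷ ts) = just t ∷ pad d ts

branches : ∀ d → Tree → Vec Tree₀ d
branches d (node ts) = pad d ts

branch : ∀ d → Tree → Fin d → Tree₀
branch d D = Vec.lookup (branches d D)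

SameBranches : ∀ d → Tree → Permutation′ d → Permutation′ d → Set
SameBranches d D π π′ = ∀ j → branch d D (π ⟨$⟩ʳ j) ≅ᴹ branch d D (π′ ⟨$⟩ʳ j)

record IsCompleteSetOfRepresentatives
         (d : ℕ) (D : Tree) (M : List (Permutation′ d)) : Set where
  field
    inequivalent : AllPairs (λ π π′ → ¬ SameBranches d D π π′) M
    complete     : ∀ π → Any (SameBranches d D π) M

m : ∀ d → Tree → ℕ → ℕ
m d D j = Vec.count (λ B → ‖ B ‖₀ ℕ.≟ j) (branches d D)

-- The product over all j ≥ 0 of (m d D j)!; no branch has more leaves than D, so
-- the factors with j > ‖ D ‖ are 0! = 1.
∏m! : ℕ → Tree → ℕ
∏m! d D = product (List.map (λ j → m d D j !) (upTo (suc ‖ D ‖)))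

{-# OPTIONS --safe #-}
module Submission where

-- Let G and H be the numbers of permutations of the branches D_j of D that
-- preserve their isomorphism types, respectively their numbers of leaves.  A set
-- of leaves of T that induces D and does not lie in a single branch of T splits
-- into sets inducing the D_j in the branches T_i, in exactly G ways up to
-- indexing, so
--   G (c(D,T) - Σ c(D,T_i)) ≤ per (c(D_j,T_i)),
-- and counting leaf sets by size in the same way gives the Vandermonde inequality
--   per (C(n_i,k_j)) ≤ H (C(n,k) - Σ C(n_i,k)).
-- If I(D_j) < a_j, then c(D_j,T_i) ≤ a_j C(n_i,k_j) up to a bounded error, which
-- is absent when k_j ≤ 1.  The total error at a vertex with n leaves below it is
-- therefore O(n^(k-2)), and it sums to O(n^(k-1)) over the whole tree.  By
-- induction G c(D,T) ≤ H (Π a_j) C(n,k) + O(n^(k-1)), so I(D) ≤ (H/G) Π I(D_j).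
-- Finally H = Π m_j!, and d! ≤ |M| G by completeness of M.

open import Defs
open import Data.Fin.Base using (Fin; zero; suc; punchIn)
open import Data.Fin.Permutation as Perm using (Permutation′; _⟨$⟩ʳ_)
open import Data.Fin.Subset using (Subset; inside; outside; ∣_∣)
import Data.Integer.Base as ℤ
import Data.Integer.Properties as ℤ
open import Data.List.Base as List
  using (List; []; _∷_; _++_; length; tabulate; lookup; removeAt; catMaybes; fromMaybe; filter; applyUpTo; upTo)
open import Data.List.Properties using (∷-injective; length-map; tabulate-cong)
open import Data.List.Relation.Unary.All using (All; []; _∷_)
open import Data.List.Relation.Unary.Any using (Any; here; there)
open import Data.Maybe.Base using (just; nothing; maybe′)
open import Data.Maybe.Properties using (just-injective)
import Data.Maybe.Relation.Binary.Pointwise as Pointwise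
open import Data.Maybe.Relation.Unary.All as Maybe using (just; nothing)
open import Data.Nat.Base
open import Data.Nat.Combinatorics using (_C_; nCk+nC[k+1]≡[n+1]C[k+1]; k>n⇒nCk≡0; nC1≡n)
open import Data.Nat.ListAction using (sum; product)
open import Data.Nat.Properties
open import Data.Nat.Tactic.RingSolver using (solve-∀)
open import Data.Product.Base using (∃; _×_; _,_; proj₁; proj₂)
open import Data.Rational.Base as ℚ using (ℚ; 0ℚ)
import Data.Rational.Properties as ℚ
import Data.Rational.Unnormalised.Base as ℚᵘ
import Data.Rational.Unnormalised.Properties as ℚᵘ
open import Data.Sum.Base using (inj₁; inj₂)
open import Data.Vec.Base as Vec using (Vec; []; _∷_; toList; take; drop; map)
open import Function.Base using (_∘_)
import Relation.Binary.Construct.On as On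
open import Relation.Binary.Definitions using (Decidable)
open import Relation.Binary.PropositionalEquality
open import Relation.Binary.Structures using (IsEquivalence)
open import Relation.Nullary
import Algebra.Properties.CommutativeMonoid.Sum +-0-commutativeMonoid as Fin-Sum
open import Algebra.Properties.CommutativeSemigroup +-commutativeSemigroup using ()
  renaming (interchange to +-interchange; x∙yz≈y∙xz to m+[n+o]≡n+[m+o])
open import Algebra.Properties.CommutativeSemigroup *-commutativeSemigroup using ()
  renaming (interchange to *-interchange; x∙yz≈y∙xz to m*[n*o]≡n*[m*o])

-- The limsup defining I(D_j) says nothing about small trees, and branches of T may be small however
-- large T is; hence the additive error in the estimate of c(D_j,T_i). Its order is critical. A
-- caterpillar on n leaves has about n internal vertices, most with linearly many leaves below them,
-- so errors of order n^(k-1) at each vertex could add up to n^k and destroy the bound. A bounded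
-- error in a row with k_j ≥ 2 is harmless, as the other rows contribute at most order n^(k-k_j) ≤
-- n^(k-2). For k_j ≤ 1 the error must be 0, and it can be: an empty tree or a single leaf has
-- inducibility at least 1, so the total number of leaf sets already suffices as a bound.
--
-- Permanents enter through their linearity in each column. A leaf set of T is a tuple of leaf sets
-- of its branches, and both inequalities are first checked for one tuple, where the permanent of a
-- 0/1 matrix is 0 or the constant G (respectively H); summation over all tuples turns the entries
-- into counts.
--
-- Denominators are cleared throughout, so that the estimates live in the natural numbers.

-- Finite sums and indicators.

∑ : {A : Set} → List A → (A → ℕ) → ℕ
∑ []       f = 0
∑ (x ∷ xs) f = f x + ∑ xs f

module _ {A : Set} where

  ∑-cong : {f g : A → ℕ} → (∀ x → f x ≡ g x) → ∀ xs → ∑ xs f ≡ ∑ xs g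
  ∑-cong f≡g []       = refl
  ∑-cong f≡g (x ∷ xs) = cong₂ _+_ (f≡g x) (∑-cong f≡g xs)

  ∑-mono-≤ : {f g : A → ℕ} → (∀ x → f x ≤ g x) → ∀ xs → ∑ xs f ≤ ∑ xs g
  ∑-mono-≤ f≤g []       = z≤n
  ∑-mono-≤ f≤g (x ∷ xs) = +-mono-≤ (f≤g x) (∑-mono-≤ f≤g xs)

  ∑-zero : (xs : List A) → ∑ xs (λ _ → 0) ≡ 0
  ∑-zero []       = refl
  ∑-zero (x ∷ xs) = ∑-zero xs

  ∑-const : ∀ c (xs : List A) → ∑ xs (λ _ → c) ≡ length xs * c
  ∑-const c []       = refl
  ∑-const c (x ∷ xs) = cong (c +_) (∑-const c xs)

  ∑-distrib-+ : (f g : A → ℕ) → ∀ xs → ∑ xs (λ x → f x + g x) ≡ ∑ xs f + ∑ xs g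
  ∑-distrib-+ f g []       = refl
  ∑-distrib-+ f g (x ∷ xs) =
    trans (cong (f x + g x +_) (∑-distrib-+ f g xs)) (+-interchange (f x) (g x) _ _)

  *-distribˡ-∑ : ∀ c (f : A → ℕ) xs → ∑ xs (λ x → c * f x) ≡ c * ∑ xs f
  *-distribˡ-∑ c f []       = sym (*-zeroʳ c)
  *-distribˡ-∑ c f (x ∷ xs) =
    trans (cong (c * f x +_) (*-distribˡ-∑ c f xs)) (sym (*-distribˡ-+ c (f x) _))

  *-distribʳ-∑ : ∀ c (f : A → ℕ) xs → ∑ xs (λ x → f x * c) ≡ ∑ xs f * c
  *-distribʳ-∑ c f xs =
    trans (∑-cong (λ x → *-comm (f x) c) xs) (trans (*-distribˡ-∑ c f xs) (*-comm c _))

  ∑-++ : ∀ (f : A → ℕ) xs ys → ∑ (xs ++ ys) f ≡ ∑ xs f + ∑ ys f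
  ∑-++ f []       ys = refl
  ∑-++ f (x ∷ xs) ys = trans (cong (f x +_) (∑-++ f xs ys)) (sym (+-assoc (f x) _ _))

  ∑-map : {B : Set} (h : B → A) (f : A → ℕ) → ∀ xs → ∑ (List.map h xs) f ≡ ∑ xs (f ∘ h)
  ∑-map h f []       = refl
  ∑-map h f (x ∷ xs) = cong (f (h x) +_) (∑-map h f xs)

∑-swap : {A B : Set} (f : A → B → ℕ) → ∀ xs ys →
         ∑ xs (λ x → ∑ ys (f x)) ≡ ∑ ys (λ y → ∑ xs (λ x → f x y))
∑-swap f []       ys = sym (∑-zero ys)
∑-swap f (x ∷ xs) ys =
  trans (cong (∑ ys (f x) +_) (∑-swap f xs ys)) (sym (∑-distrib-+ (f x) _ ys))

⟦_⟧ : {P : Set} → Dec P → ℕ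
⟦ yes _ ⟧ = 1
⟦ no  _ ⟧ = 0

⟦⟧-mono : {P Q : Set} (p : Dec P) (q : Dec Q) → (P → Q) → ⟦ p ⟧ ≤ ⟦ q ⟧
⟦⟧-mono (yes p) (yes q) f = ≤-refl
⟦⟧-mono (yes p) (no ¬q) f = contradiction (f p) ¬q
⟦⟧-mono (no ¬p) q       f = z≤n

⟦⟧-cong : {P Q : Set} (p : Dec P) (q : Dec Q) → (P → Q) → (Q → P) → ⟦ p ⟧ ≡ ⟦ q ⟧
⟦⟧-cong p q f g = ≤-antisym (⟦⟧-mono p q f) (⟦⟧-mono q p g)

⟦⟧-true : {P : Set} (p : Dec P) → P → ⟦ p ⟧ ≡ 1
⟦⟧-true p x = ⟦⟧-cong p (yes x) (λ z → z) (λ z → z)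

⟦⟧-false : {P : Set} (p : Dec P) → ¬ P → ⟦ p ⟧ ≡ 0
⟦⟧-false p x = ⟦⟧-cong p (no x) (λ z → z) (λ z → z)

⟦⟧≢0 : {P : Set} (p : Dec P) → ⟦ p ⟧ ≢ 0 → P
⟦⟧≢0 (yes p) _ = p
⟦⟧≢0 (no _) ne = contradiction refl ne

*≢0 : ∀ m {n} → m * n ≢ 0 → m ≢ 0 × n ≢ 0
*≢0 m h = (λ { refl → h refl }) , (λ { refl → h (*-zeroʳ m) })

-- Removal of one entry from a list.

module _ {A : Set} where

  -- A relation instead of `lookup` and `removeAt`: two successive removals can then be exchanged
  -- without index arithmetic.
  data Pick (x : A) : List A → List A → Set where
    here  : ∀ {xs} → Pick x (x ∷ xs) xs
    there : ∀ {y xs ys} → Pick x xs ys → Pick x (y ∷ xs) (y ∷ ys)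

  pick-swap : ∀ {x y xs ys zs} → Pick x xs ys → Pick y ys zs →
              ∃ λ ws → Pick y xs ws × Pick x ws zs
  pick-swap here      q         = _ , there q , here
  pick-swap (there p) here      = _ , here , p
  pick-swap (there p) (there q) = let _ , r , s = pick-swap p q in _ , there r , there s

  ∑-pick : ∀ (f : A → ℕ) {x xs ys} → Pick x xs ys → ∑ xs f ≡ f x + ∑ ys f
  ∑-pick f here      = refl
  ∑-pick f {x} (there {y} {_} {ys} p) =
    trans (cong (f y +_) (∑-pick f p)) (m+[n+o]≡n+[m+o] (f y) (f x) _)

  All-pick : ∀ {P : A → Set} {x xs ys} → Pick x xs ys → All P xs → P x × All P ys
  All-pick here      (px ∷ pxs) = px , pxs
  All-pick (there p) (py ∷ pxs) = let px , pys = All-pick p pxs in px , py ∷ pys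

  length-pick : ∀ {x : A} {xs ys} → Pick x xs ys → length xs ≡ suc (length ys)
  length-pick here      = refl
  length-pick (there p) = cong suc (length-pick p)

  -- The sum of g x ys over all ways of removing one entry x from a list,
  -- ys being what remains.
  ∑ᴾ : (A → List A → ℕ) → List A → ℕ
  ∑ᴾ g []       = 0
  ∑ᴾ g (x ∷ xs) = g x xs + ∑ᴾ (λ y ys → g y (x ∷ ys)) xs

  ∑ᴾ-mono-≤ : ∀ {g h} xs → (∀ {x ys} → Pick x xs ys → g x ys ≤ h x ys) → ∑ᴾ g xs ≤ ∑ᴾ h xs
  ∑ᴾ-mono-≤ []       le = z≤n
  ∑ᴾ-mono-≤ (x ∷ xs) le = +-mono-≤ (le here) (∑ᴾ-mono-≤ xs (le ∘ there))

  ∑ᴾ-cong : ∀ {g h} xs → (∀ {x ys} → Pick x xs ys → g x ys ≡ h x ys) → ∑ᴾ g xs ≡ ∑ᴾ h xs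
  ∑ᴾ-cong []       eq = refl
  ∑ᴾ-cong (x ∷ xs) eq = cong₂ _+_ (eq here) (∑ᴾ-cong xs (eq ∘ there))

  ∑ᴾ-+ : ∀ g h xs → ∑ᴾ (λ x ys → g x ys + h x ys) xs ≡ ∑ᴾ g xs + ∑ᴾ h xs
  ∑ᴾ-+ g h []       = refl
  ∑ᴾ-+ g h (x ∷ xs) = trans (cong (_ +_) (∑ᴾ-+ _ _ xs)) (+-interchange (g x xs) _ _ _)

  ∑ᴾ-* : ∀ c g xs → ∑ᴾ (λ x ys → c * g x ys) xs ≡ c * ∑ᴾ g xs
  ∑ᴾ-* c g []       = sym (*-zeroʳ c)
  ∑ᴾ-* c g (x ∷ xs) = trans (cong (_ +_) (∑ᴾ-* c _ xs)) (sym (*-distribˡ-+ c (g x xs) _))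

  ∑ᴾ-const : ∀ c xs → ∑ᴾ (λ _ _ → c) xs ≡ length xs * c
  ∑ᴾ-const c []       = refl
  ∑ᴾ-const c (x ∷ xs) = cong (c +_) (∑ᴾ-const c xs)

  ∑ᴾ-head : ∀ (f : A → ℕ) xs → ∑ᴾ (λ x _ → f x) xs ≡ ∑ xs f
  ∑ᴾ-head f []       = refl
  ∑ᴾ-head f (x ∷ xs) = cong (f x +_) (∑ᴾ-head f xs)

  ∑-∑ᴾ : ∀ {B : Set} (g : B → A → List A → ℕ) bs xs →
         ∑ bs (λ b → ∑ᴾ (g b) xs) ≡ ∑ᴾ (λ x ys → ∑ bs (λ b → g b x ys)) xs
  ∑-∑ᴾ g bs []       = ∑-zero bs
  ∑-∑ᴾ g bs (x ∷ xs) =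
    trans (∑-distrib-+ (λ b → g b x xs) _ bs)
          (cong (_ +_) (∑-∑ᴾ (λ b y ys → g b y (x ∷ ys)) bs xs))

  ∑ᴾ≢0 : ∀ g xs → ∑ᴾ g xs ≢ 0 → ∃ λ x → ∃ λ ys → Pick x xs ys × g x ys ≢ 0
  ∑ᴾ≢0 g []       ne = contradiction refl ne
  ∑ᴾ≢0 g (x ∷ xs) ne with g x xs ≟ 0
  ... | no ne′ = x , xs , here , ne′
  ... | yes e  = let y , ys , p , ne′ = ∑ᴾ≢0 _ xs (λ e′ → ne (cong₂ _+_ e e′))
                 in y , x ∷ ys , there p , ne′

-- Permanents and their multilinearity.

-- The permanent of the matrix (f a b), with rows indexed by as and columns
-- by bs, expanded along the first row.
per : {A B : Set} → (A → B → ℕ) → List A → List B → ℕ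
per f []       []      = 1
per f []       (_ ∷ _) = 0
per f (a ∷ as) bs      = ∑ᴾ (λ b bs′ → f a b * per f as bs′) bs

module _ {A B : Set} where

  per-cong : {f g : A → B → ℕ} → (∀ a b → f a b ≡ g a b) → ∀ as bs → per f as bs ≡ per g as bs
  per-cong eq []       []      = refl
  per-cong eq []       (_ ∷ _) = refl
  per-cong eq (a ∷ as) bs      = ∑ᴾ-cong bs λ {b} {bs′} _ → cong₂ _*_ (eq a b) (per-cong eq as bs′)

  -- A nonzero permanent has a nonzero term, that is, a bijection of rows with columns along which
  -- `f` never vanishes; along it `h` and `h′` agree.
  per≢0⇒∑≡ : {f : A → B → ℕ} {h : A → ℕ} {h′ : B → ℕ} →
             (∀ a b → f a b ≢ 0 → h a ≡ h′ b) →
             ∀ as bs → per f as bs ≢ 0 → ∑ as h ≡ ∑ bs h′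
  per≢0⇒∑≡ eq []       []      ne = refl
  per≢0⇒∑≡ eq []       (_ ∷ _) ne = contradiction refl ne
  per≢0⇒∑≡ {f} {h} {h′} eq (a ∷ as) bs ne =
    let b , bs′ , p , ne′ = ∑ᴾ≢0 _ bs ne
        f≢0 , per≢0       = *≢0 (f a b) ne′
    in trans (cong₂ _+_ (eq a b f≢0) (per≢0⇒∑≡ eq as bs′ per≢0)) (sym (∑-pick h′ p))

-- A sum over the Cartesian product of the lists. Below, a tuple arises from one leaf set in each
-- branch.
∑ˣ : {B : Set} → List (List B) → (List B → ℕ) → ℕ
∑ˣ []       F = F []
∑ˣ (P ∷ Ps) F = ∑ P λ u → ∑ˣ Ps λ us → F (u ∷ us)

module _ {B : Set} where

  ∑ˣ-cong : {F G : List B → ℕ} → ∀ Ps → (∀ us → length us ≡ length Ps → F us ≡ G us) → ∑ˣ Ps F ≡ ∑ˣ Ps G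
  ∑ˣ-cong []       eq = eq [] refl
  ∑ˣ-cong (P ∷ Ps) eq = ∑-cong (λ u → ∑ˣ-cong Ps λ us l → eq (u ∷ us) (cong suc l)) P

  ∑ˣ-mono-≤ : {F G : List B → ℕ} → ∀ Ps → (∀ us → length us ≡ length Ps → F us ≤ G us) → ∑ˣ Ps F ≤ ∑ˣ Ps G
  ∑ˣ-mono-≤ []       le = le [] refl
  ∑ˣ-mono-≤ (P ∷ Ps) le = ∑-mono-≤ (λ u → ∑ˣ-mono-≤ Ps λ us l → le (u ∷ us) (cong suc l)) P

  ∑ˣ-+ : ∀ Ps (F G : List B → ℕ) → ∑ˣ Ps (λ us → F us + G us) ≡ ∑ˣ Ps F + ∑ˣ Ps G
  ∑ˣ-+ []       F G = refl
  ∑ˣ-+ (P ∷ Ps) F G = trans (∑-cong (λ u → ∑ˣ-+ Ps _ _) P) (∑-distrib-+ _ _ P)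

  ∑ˣ-* : ∀ c Ps (F : List B → ℕ) → ∑ˣ Ps (λ us → c * F us) ≡ c * ∑ˣ Ps F
  ∑ˣ-* c []       F = refl
  ∑ˣ-* c (P ∷ Ps) F = trans (∑-cong (λ u → ∑ˣ-* c Ps _) P) (*-distribˡ-∑ c _ P)

  ∑ˣ-∑ᴾ : ∀ (g : B → List B → ℕ) Ps →
          ∑ˣ Ps (∑ᴾ g) ≡ ∑ᴾ (λ P Qs → ∑ P λ u → ∑ˣ Qs (g u)) Ps
  ∑ˣ-∑ᴾ g []       = refl
  ∑ˣ-∑ᴾ g (P ∷ Ps) = begin
    ∑ P (λ u → ∑ˣ Ps λ us → g u us + ∑ᴾ (λ y ys → g y (u ∷ ys)) us)
      ≡⟨ ∑-cong (λ u → ∑ˣ-+ Ps _ _) P ⟩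
    ∑ P (λ u → ∑ˣ Ps (g u) + ∑ˣ Ps (∑ᴾ (λ y ys → g y (u ∷ ys))))
      ≡⟨ ∑-distrib-+ _ _ P ⟩
    S + ∑ P (λ u → ∑ˣ Ps (∑ᴾ (λ y ys → g y (u ∷ ys))))
      ≡⟨ cong (S +_) (∑-cong (λ u → ∑ˣ-∑ᴾ (λ y ys → g y (u ∷ ys)) Ps) P) ⟩
    S + ∑ P (λ u → ∑ᴾ (λ Q Qs → ∑ Q λ v → ∑ˣ Qs λ us → g v (u ∷ us)) Ps)
      ≡⟨ cong (S +_) (∑-∑ᴾ _ P Ps) ⟩
    S + ∑ᴾ (λ Q Qs → ∑ P λ u → ∑ Q λ v → ∑ˣ Qs λ us → g v (u ∷ us)) Ps
      ≡⟨ cong (S +_) (∑ᴾ-cong Ps λ {Q} _ → ∑-swap _ P Q) ⟩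
    S + ∑ᴾ (λ Q Qs → ∑ Q λ v → ∑ P λ u → ∑ˣ Qs λ us → g v (u ∷ us)) Ps ∎
    where
    open ≡-Reasoning
    S = ∑ P (λ u → ∑ˣ Ps (g u))

  -- The permanent is linear in each column, so independent sums over the columns move into the
  -- entries.
  ∑ˣ-per : ∀ {A : Set} (f : A → B → ℕ) as Ps →
           ∑ˣ Ps (per f as) ≡ per (λ a P → ∑ P (f a)) as Ps
  ∑ˣ-per f []       []       = refl
  ∑ˣ-per f []       (P ∷ Ps) = trans (∑-cong (λ u → ∑ˣ-zero Ps) P) (∑-zero P)
    where
    ∑ˣ-zero : ∀ Ps → ∑ˣ Ps (λ _ → 0) ≡ 0
    ∑ˣ-zero []       = refl
    ∑ˣ-zero (P ∷ Ps) = trans (∑-cong (λ _ → ∑ˣ-zero Ps) P) (∑-zero P)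
  ∑ˣ-per f (a ∷ as) Ps = trans (∑ˣ-∑ᴾ _ Ps) (∑ᴾ-cong Ps λ {P} {Qs} _ → begin
    ∑ P (λ u → ∑ˣ Qs λ us → f a u * per f as us) ≡⟨ ∑-cong (λ u → ∑ˣ-* (f a u) Qs _) P ⟩
    ∑ P (λ u → f a u * ∑ˣ Qs (per f as))         ≡⟨ *-distribʳ-∑ (∑ˣ Qs (per f as)) (f a) P ⟩
    ∑ P (f a) * ∑ˣ Qs (per f as)                 ≡⟨ cong (∑ P (f a) *_) (∑ˣ-per f as Qs) ⟩
    ∑ P (f a) * per (λ a P → ∑ P (f a)) as Qs    ∎)
    where open ≡-Reasoning

per-map : {A B C : Set} (f : A → C → ℕ) (h : B → C) → ∀ as bs →
          per f as (List.map h bs) ≡ per (λ a b → f a (h b)) as bs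
per-map f h []       []      = refl
per-map f h []       (_ ∷ _) = refl
per-map f h (a ∷ as) bs      =
  trans (∑ᴾ-map _ bs) (∑ᴾ-cong bs λ {b} {bs′} _ → cong (f a (h b) *_) (per-map f h as bs′))
  where
  ∑ᴾ-map : ∀ g bs → ∑ᴾ g (List.map h bs) ≡ ∑ᴾ (λ b bs′ → g (h b) (List.map h bs′)) bs
  ∑ᴾ-map g []       = refl
  ∑ᴾ-map g (b ∷ bs) = cong (g (h b) (List.map h bs) +_) (∑ᴾ-map _ bs)

-- Bijections that preserve equivalence classes.

module Classes {A : Set} {R : A → A → Set} (R? : Decidable R) (≈ : IsEquivalence R) where
  private module ≈ = IsEquivalence ≈

  δ : A → A → ℕ
  δ a b = ⟦ R? a b ⟧

  mult : A → List A → ℕ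
  mult a bs = ∑ bs (δ a)

  -- The product of the factorials of the sizes of the R-classes.
  Φ : List A → ℕ
  Φ []       = 1
  Φ (a ∷ as) = mult a (a ∷ as) * Φ as

  δ-refl : ∀ a → δ a a ≡ 1
  δ-refl a = ⟦⟧-true (R? a a) ≈.refl

  δ-cong : ∀ x {a b} → R a b → δ x a ≡ δ x b
  δ-cong x r = ⟦⟧-cong (R? x _) (R? x _) (λ p → ≈.trans p r) (λ p → ≈.trans p (≈.sym r))

  Φ≢0 : ∀ as → Φ as ≢ 0
  Φ≢0 []       ()
  Φ≢0 (a ∷ as) e with m*n≡0⇒m≡0∨n≡0 (mult a (a ∷ as)) e
  ... | inj₂ e′ = Φ≢0 as e′
  ... | inj₁ e′ with trans (sym e′) (cong (_+ mult a as) (δ-refl a))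
  ...   | ()

  -- The permanent counts the class-preserving bijections. The first row has `mult a bs` possible
  -- partners; since `δ x` is constant on classes, removing any of them leaves lists with equal
  -- multiplicities again.
  per-matched : ∀ as bs → (∀ x → mult x as ≡ mult x bs) → per δ as bs ≡ Φ as
  per-matched []       []       eq = refl
  per-matched []       (b ∷ bs) eq with trans (eq b) (cong (_+ mult b bs) (δ-refl b))
  ... | ()
  per-matched (a ∷ as) bs eq = begin
    ∑ᴾ (λ b bs′ → δ a b * per δ as bs′) bs ≡⟨ ∑ᴾ-cong bs step ⟩
    ∑ᴾ (λ b bs′ → δ a b * Φ as) bs         ≡⟨ ∑ᴾ-head (λ b → δ a b * Φ as) bs ⟩
    ∑ bs (λ b → δ a b * Φ as)              ≡⟨ *-distribʳ-∑ (Φ as) (δ a) bs ⟩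
    mult a bs * Φ as                       ≡⟨ cong (_* Φ as) (eq a) ⟨
    mult a (a ∷ as) * Φ as                 ∎
    where
    open ≡-Reasoning
    step : ∀ {b bs′} → Pick b bs bs′ → δ a b * per δ as bs′ ≡ δ a b * Φ as
    step {b} {bs′} p with R? a b
    ... | no  _ = refl
    ... | yes r = cong (1 *_) (per-matched as bs′ λ x →
      +-cancelˡ-≡ (δ x a) _ _
        (trans (eq x) (trans (∑-pick (δ x) p) (cong (_+ mult x bs′) (sym (δ-cong x r))))))

  per≢0⇒matched : ∀ as bs → per δ as bs ≢ 0 → ∀ x → mult x as ≡ mult x bs
  per≢0⇒matched as bs ne x =
    per≢0⇒∑≡ {h = δ x} {h′ = δ x} (λ a b ne′ → δ-cong x (⟦⟧≢0 (R? a b) ne′)) as bs ne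

-- Permutations covered by a list of representatives.

∑ᴾ-tabulate : ∀ {B : Set} {n} (g : B → List B → ℕ) (b : Fin (suc n) → B) →
              ∑ᴾ g (tabulate b) ≡ sum (tabulate λ i → g (b i) (tabulate (b ∘ punchIn i)))
∑ᴾ-tabulate {n = zero}  g b = refl
∑ᴾ-tabulate {n = suc n} g b =
  cong (g (b zero) (tabulate (b ∘ suc)) +_) (∑ᴾ-tabulate (λ y ys → g y (b zero ∷ ys)) (b ∘ suc))

*-sum-≤-∑ : ∀ {X : Set} {n c} (xs : List X) (v : X → ℕ) (h : X → Fin n → ℕ) →
            (∀ i → c ≤ ∑ xs (λ x → v x * h x i)) →
            n * c ≤ ∑ xs (λ x → v x * sum (tabulate (h x)))
*-sum-≤-∑ {n = zero}      xs v h le = z≤n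
*-sum-≤-∑ {n = suc n} {c} xs v h le = begin
  c + n * c
    ≤⟨ +-mono-≤ (le zero) (*-sum-≤-∑ xs v (λ x → h x ∘ suc) (le ∘ suc)) ⟩
  ∑ xs (λ x → v x * h x zero) + ∑ xs (λ x → v x * sum (tabulate (h x ∘ suc)))
    ≡⟨ ∑-distrib-+ _ _ xs ⟨
  ∑ xs (λ x → v x * h x zero + v x * sum (tabulate (h x ∘ suc)))
    ≡⟨ ∑-cong (λ x → sym (*-distribˡ-+ (v x) (h x zero) _)) xs ⟩
  ∑ xs (λ x → v x * sum (tabulate (h x))) ∎
  where open ≤-Reasoning

-- This is the hypothesis summed over all permutations, each split into the image `i` of `zero` and
-- a permutation of the rest. The weight `v` serves the induction: it absorbs the entry of the row
-- already expanded.
!≤∑-per : ∀ {X A B : Set} {n} (f : A → B → ℕ) (xs : List X) (v : X → ℕ)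
          (a : Fin n → A) (b : X → Fin n → B) →
          (∀ (π : Permutation′ n) →
             1 ≤ ∑ xs (λ x → v x * product (tabulate λ i → f (a i) (b x (π ⟨$⟩ʳ i))))) →
          n ! ≤ ∑ xs (λ x → v x * per f (tabulate a) (tabulate (b x)))
!≤∑-per {n = zero}  f xs v a b le = le Perm.id
!≤∑-per {n = suc n} f xs v a b le = begin
  suc n * n !
    ≤⟨ *-sum-≤-∑ xs v _ (λ i → begin
         n !
           ≤⟨ !≤∑-per f xs (λ x → v x * f (a zero) (b x i)) (a ∘ suc) (λ x → b x ∘ punchIn i) (λ π → begin
                1
                  ≤⟨ le (Perm.insert zero i π) ⟩
                ∑ xs (λ x → v x * (f (a zero) (b x i) *
                  product (tabulate λ j → f (a (suc j)) (b x (Perm.insert zero i π ⟨$⟩ʳ suc j)))))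
                  ≡⟨ ∑-cong (λ x → trans
                       (cong (λ z → v x * (f (a zero) (b x i) * product z))
                         (tabulate-cong λ j →
                           cong (λ z → f (a (suc j)) (b x z)) (Perm.insert-punchIn zero i π j)))
                       (sym (*-assoc (v x) _ _))) xs ⟩
                ∑ xs (λ x → v x * f (a zero) (b x i) *
                  product (tabulate λ j → f (a (suc j)) (b x (punchIn i (π ⟨$⟩ʳ j))))) ∎) ⟩
         ∑ xs (λ x → v x * f (a zero) (b x i) * per f (tabulate (a ∘ suc)) (tabulate (b x ∘ punchIn i)))
           ≡⟨ ∑-cong (λ x → *-assoc (v x) _ _) xs ⟩
         ∑ xs (λ x → v x * (f (a zero) (b x i) * per f (tabulate (a ∘ suc)) (tabulate (b x ∘ punchIn i)))) ∎) ⟩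
  ∑ xs (λ x → v x * sum (tabulate λ i →
    f (a zero) (b x i) * per f (tabulate (a ∘ suc)) (tabulate (b x ∘ punchIn i))))
    ≡⟨ ∑-cong (λ x → cong (v x *_) (∑ᴾ-tabulate (λ y ys → f (a zero) y * per f (tabulate (a ∘ suc)) ys) (b x))) xs ⟨
  ∑ xs (λ x → v x * per f (tabulate a) (tabulate (b x))) ∎
  where open ≤-Reasoning

-- Isomorphism of trees as an equivalence relation.

pickAt : ∀ {A : Set} (xs : List A) i → Pick (lookup xs i) xs (removeAt xs i)
pickAt (x ∷ xs) zero    = here
pickAt (x ∷ xs) (suc i) = there (pickAt xs i)

pick-match : ∀ {t u ts us us′} → Pick u us us′ → t ≅ u → ts ≅* us′ → (t ∷ ts) ≅* us
pick-match {t} {u} {ts} {us} {us′} p e es =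
  let i , p≡ , q≡ = index p in
  match i (subst (t ≅_) (sym p≡) e) (subst (ts ≅*_) (sym q≡) es)
  where
  index : ∀ {us us′} → Pick u us us′ → ∃ λ i → lookup us i ≡ u × removeAt us i ≡ us′
  index here      = zero , refl , refl
  index (there p) = let i , e , e′ = index p in suc i , e , cong (_ ∷_) e′

-- A matching exposes only the partner of the head; exchanging removals opens it at any entry, as
-- transitivity requires.
≅*-pick : ∀ {u us us′ vs} → us ≅* vs → Pick u us us′ →
          ∃ λ v → ∃ λ vs′ → Pick v vs vs′ × u ≅ v × us′ ≅* vs′
≅*-pick (match i p ps) here      = _ , _ , pickAt _ i , p , ps
≅*-pick (match i p ps) (there q) =
  let _ , _ , r , e , es = ≅*-pick ps q
      _ , r′ , s         = pick-swap (pickAt _ i) r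
  in _ , _ , r′ , e , pick-match s p es

mutual
  ≅-refl : ∀ {t} → t ≅ t
  ≅-refl {node ts} = iso ≅*-refl

  ≅*-refl : ∀ {ts} → ts ≅* ts
  ≅*-refl {[]}     = []
  ≅*-refl {t ∷ ts} = match zero ≅-refl ≅*-refl

≅*-insert : ∀ {t ts u us us′} → Pick u us us′ → u ≅ t → us′ ≅* ts → us ≅* (t ∷ ts)
≅*-insert here      e es             = match zero e es
≅*-insert (there q) e (match j p ps) = match (suc j) p (≅*-insert q e ps)

mutual
  ≅-sym : ∀ {t u} → t ≅ u → u ≅ t
  ≅-sym (iso p) = iso (≅*-sym p)

  ≅*-sym : ∀ {ts us} → ts ≅* us → us ≅* ts
  ≅*-sym []             = []
  ≅*-sym (match i p ps) = ≅*-insert (pickAt _ i) (≅-sym p) (≅*-sym ps)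

mutual
  ≅-trans : ∀ {t u v} → t ≅ u → u ≅ v → t ≅ v
  ≅-trans (iso p) (iso q) = iso (≅*-trans p q)

  ≅*-trans : ∀ {ts us vs} → ts ≅* us → us ≅* vs → ts ≅* vs
  ≅*-trans []             []  = []
  ≅*-trans (match i p ps) q =
    let _ , _ , r , e , es = ≅*-pick q (pickAt _ i)
    in pick-match r (≅-trans p e) (≅*-trans ps es)

≅ᴹ-isEquivalence : IsEquivalence _≅ᴹ_
≅ᴹ-isEquivalence = Pointwise.isEquivalence (record { refl = ≅-refl ; sym = ≅-sym ; trans = ≅-trans })

≅*-∑ : ∀ (h : Tree → ℕ) → (∀ {t u} → t ≅ u → h t ≡ h u) → ∀ {ts us} → ts ≅* us → ∑ ts h ≡ ∑ us h
≅*-∑ h h-cong []             = refl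
≅*-∑ h h-cong (match {us = us} i p ps) =
  trans (cong₂ _+_ (h-cong p) (≅*-∑ h h-cong ps)) (sym (∑-pick h (pickAt us i)))

-- Numbers of leaves.

‖‖*≡∑ : ∀ ts → ‖ ts ‖* ≡ ∑ ts ‖_‖
‖‖*≡∑ []       = refl
‖‖*≡∑ (t ∷ ts) = cong (‖ t ‖ +_) (‖‖*≡∑ ts)

‖t‖>0 : ∀ t → 0 < ‖ t ‖
‖t‖>0 (node [])       = ≤-refl
‖t‖>0 (node (t ∷ ts)) = ≤-trans (‖t‖>0 t) (m≤m+n ‖ t ‖ _)

mutual
  ≅⇒‖‖≡ : ∀ {t u} → t ≅ u → ‖ t ‖ ≡ ‖ u ‖
  ≅⇒‖‖≡ (iso {[]}     {[]}     p)              = refl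
  ≅⇒‖‖≡ (iso {t ∷ ts} {u ∷ us} p@(match _ _ _)) = ≅*⇒‖‖*≡ p
  ≅⇒‖‖≡ (iso {t ∷ ts} {[]}     (match () _ _))

  ≅*⇒‖‖*≡ : ∀ {ts us} → ts ≅* us → ‖ ts ‖* ≡ ‖ us ‖*
  ≅*⇒‖‖*≡ []                      = refl
  ≅*⇒‖‖*≡ (match {t} {ts} {us} i p ps) = begin
    ‖ t ‖ + ‖ ts ‖*                             ≡⟨ cong₂ _+_ (≅⇒‖‖≡ p) (≅*⇒‖‖*≡ ps) ⟩
    ‖ lookup us i ‖ + ‖ removeAt us i ‖*  ≡⟨ cong (‖ lookup us i ‖ +_) (‖‖*≡∑ (removeAt us i)) ⟩
    ‖ lookup us i ‖ + ∑ (removeAt us i) ‖_‖ ≡⟨ ∑-pick ‖_‖ (pickAt us i) ⟨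
    ∑ us ‖_‖                              ≡⟨ ‖‖*≡∑ us ⟨
    ‖ us ‖*                               ∎
    where open ≡-Reasoning

≅ᴹ⇒‖‖₀≡ : ∀ {B B′} → B ≅ᴹ B′ → ‖ B ‖₀ ≡ ‖ B′ ‖₀
≅ᴹ⇒‖‖₀≡ (Pointwise.just p) = ≅⇒‖‖≡ p
≅ᴹ⇒‖‖₀≡ Pointwise.nothing  = refl

‖join‖₀ : ∀ ts → ‖ join ts ‖₀ ≡ ‖ ts ‖*
‖join‖₀ []           = refl
‖join‖₀ (t ∷ [])     = sym (+-identityʳ ‖ t ‖)
‖join‖₀ (_ ∷ _ ∷ _)  = refl

‖++‖* : ∀ ts us → ‖ ts ++ us ‖* ≡ ‖ ts ‖* + ‖ us ‖*
‖++‖* []       us = refl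
‖++‖* (t ∷ ts) us = trans (cong (‖ t ‖ +_) (‖++‖* ts us)) (sym (+-assoc ‖ t ‖ _ _))

‖fromMaybe‖* : ∀ u → ‖ fromMaybe u ‖* ≡ ‖ u ‖₀
‖fromMaybe‖* nothing  = refl
‖fromMaybe‖* (just t) = +-identityʳ ‖ t ‖

∣take∣+∣drop∣ : ∀ a {b} (S : Subset (a + b)) → ∣ take a S ∣ + ∣ drop a S ∣ ≡ ∣ S ∣
∣take∣+∣drop∣ zero    S             = refl
∣take∣+∣drop∣ (suc a) (inside  ∷ S) = cong suc (∣take∣+∣drop∣ a S)
∣take∣+∣drop∣ (suc a) (outside ∷ S) = ∣take∣+∣drop∣ a S

mutual
  ‖induced‖₀ : ∀ T S → ‖ induced T S ‖₀ ≡ ∣ S ∣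
  ‖induced‖₀ (node [])       (inside  ∷ []) = refl
  ‖induced‖₀ (node [])       (outside ∷ []) = refl
  ‖induced‖₀ (node (t ∷ ts)) S =
    trans (‖join‖₀ (induced* (t ∷ ts) S)) (‖induced*‖* (t ∷ ts) S)

  ‖induced*‖* : ∀ ts S → ‖ induced* ts S ‖* ≡ ∣ S ∣
  ‖induced*‖* []       []  = refl
  ‖induced*‖* (t ∷ ts) S = begin
    ‖ fromMaybe u ++ induced* ts (drop ‖ t ‖ S) ‖*       ≡⟨ ‖++‖* (fromMaybe u) _ ⟩
    ‖ fromMaybe u ‖* + ‖ induced* ts (drop ‖ t ‖ S) ‖*
      ≡⟨ cong₂ _+_ (trans (‖fromMaybe‖* u) (‖induced‖₀ t (take ‖ t ‖ S))) (‖induced*‖* ts (drop ‖ t ‖ S)) ⟩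
    ∣ take ‖ t ‖ S ∣ + ∣ drop ‖ t ‖ S ∣                  ≡⟨ ∣take∣+∣drop∣ ‖ t ‖ S ⟩
    ∣ S ∣                                                ∎
    where
    open ≡-Reasoning
    u = induced t (take ‖ t ‖ S)

-- Leaf sets and the trees they induce.

∑-subsets-+ : ∀ a b (F : Subset a → Subset b → ℕ) →
              ∑ (subsets (a + b)) (λ S → F (take a S) (drop a S)) ≡
              ∑ (subsets a) (λ S₁ → ∑ (subsets b) (F S₁))
∑-subsets-+ zero    b F = sym (+-identityʳ _)
∑-subsets-+ (suc a) b F = begin
  ∑ (List.map (inside ∷_) Ss ++ List.map (outside ∷_) Ss) _    ≡⟨ ∑-++ _ (List.map (inside ∷_) Ss) _ ⟩
  ∑ (List.map (inside ∷_) Ss) _ + ∑ (List.map (outside ∷_) Ss) _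
    ≡⟨ cong₂ _+_ (half inside) (half outside) ⟩
  ∑ (List.map (inside ∷_) (subsets a)) G + ∑ (List.map (outside ∷_) (subsets a)) G
    ≡⟨ ∑-++ G (List.map (inside ∷_) (subsets a)) _ ⟨
  ∑ (subsets (suc a)) G ∎
  where
  open ≡-Reasoning
  Ss = subsets (a + b)
  G : Subset (suc a) → ℕ
  G S₁ = ∑ (subsets b) (F S₁)
  half : ∀ s → ∑ (List.map (s ∷_) Ss) (λ S → F (take (suc a) S) (drop (suc a) S)) ≡ ∑ (List.map (s ∷_) (subsets a)) G
  half s = trans (∑-map (s ∷_) _ Ss) (trans (∑-subsets-+ a b (F ∘ (s ∷_))) (sym (∑-map (s ∷_) G (subsets a))))

∑-subsets-∣∣ : ∀ n k → ∑ (subsets n) (λ S → ⟦ k ≟ ∣ S ∣ ⟧) ≡ n C k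
∑-subsets-∣∣ zero    zero    = refl
∑-subsets-∣∣ zero    (suc k) = refl
∑-subsets-∣∣ (suc n) k       = begin
  ∑ (List.map (inside ∷_) Ss ++ List.map (outside ∷_) Ss) _ ≡⟨ ∑-++ _ (List.map (inside ∷_) Ss) _ ⟩
  _ ≡⟨ cong₂ _+_ (∑-map (inside ∷_) _ Ss) (∑-map (outside ∷_) _ Ss) ⟩
  ∑ Ss (λ S → ⟦ k ≟ suc ∣ S ∣ ⟧) + ∑ Ss (λ S → ⟦ k ≟ ∣ S ∣ ⟧)
    ≡⟨ cong (∑ Ss (λ S → ⟦ k ≟ suc ∣ S ∣ ⟧) +_) (∑-subsets-∣∣ n k) ⟩
  ∑ Ss (λ S → ⟦ k ≟ suc ∣ S ∣ ⟧) + n C k ≡⟨ pascal k ⟩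
  suc n C k ∎
  where
  open ≡-Reasoning
  Ss = subsets n
  pascal : ∀ k → ∑ Ss (λ S → ⟦ k ≟ suc ∣ S ∣ ⟧) + n C k ≡ suc n C k
  pascal zero    = cong (_+ 1) (∑-zero Ss)
  pascal (suc k) = trans
    (cong (_+ n C suc k) (trans (∑-cong (λ S → ⟦⟧-cong (suc k ≟ suc ∣ S ∣) (k ≟ ∣ S ∣) suc-injective (cong suc)) Ss)
                                (∑-subsets-∣∣ n k)))
    (nCk+nC[k+1]≡[n+1]C[k+1] n k)

-- The empty tree has one leaf set, the empty one, so a padding branch adds exactly one choice to a
-- tuple.
inducedTrees : Tree₀ → List Tree₀
inducedTrees nothing  = nothing ∷ []
inducedTrees (just T) = List.map (induced T) (subsets ‖ T ‖)

-- Extends `c` to empty trees, so that padded branches are treated uniformly. The size condition of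
-- `c` is implied by isomorphism.
copies : Tree₀ → Tree₀ → ℕ
copies B T = ∑ (inducedTrees T) λ u → ⟦ B ≅ᴹ? u ⟧

∑-inducedTrees-‖‖ : ∀ T k → ∑ (inducedTrees T) (λ u → ⟦ k ≟ ‖ u ‖₀ ⟧) ≡ ‖ T ‖₀ C k
∑-inducedTrees-‖‖ nothing  zero    = refl
∑-inducedTrees-‖‖ nothing  (suc k) = refl
∑-inducedTrees-‖‖ (just T) k       = begin
  ∑ (List.map (induced T) (subsets ‖ T ‖)) _               ≡⟨ ∑-map (induced T) _ (subsets ‖ T ‖) ⟩
  ∑ (subsets ‖ T ‖) (λ S → ⟦ k ≟ ‖ induced T S ‖₀ ⟧)
    ≡⟨ ∑-cong (λ S → cong (λ n → ⟦ k ≟ n ⟧) (‖induced‖₀ T S)) (subsets ‖ T ‖) ⟩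
  ∑ (subsets ‖ T ‖) (λ S → ⟦ k ≟ ∣ S ∣ ⟧)             ≡⟨ ∑-subsets-∣∣ ‖ T ‖ k ⟩
  ‖ T ‖ C k                                           ∎
  where open ≡-Reasoning

length-filter≡∑ : ∀ {A : Set} {P : A → Set} (P? : ∀ x → Dec (P x)) xs →
                  length (filter P? xs) ≡ ∑ xs (λ x → ⟦ P? x ⟧)
length-filter≡∑ P? []       = refl
length-filter≡∑ P? (x ∷ xs) with P? x
... | yes _ = cong suc (length-filter≡∑ P? xs)
... | no  _ = length-filter≡∑ P? xs

c≡copies : ∀ D T → c D T ≡ copies (just D) (just T)
c≡copies D T = begin
  c D T
    ≡⟨ length-filter≡∑ (inducesCopy? D T) (subsets ‖ T ‖) ⟩
  ∑ (subsets ‖ T ‖) (λ S → ⟦ inducesCopy? D T S ⟧)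
    ≡⟨ ∑-cong (λ S → ⟦⟧-cong (inducesCopy? D T S) (just D ≅ᴹ? induced T S)
                                                              (λ (_ , p) → ≈.sym p)
                                                              (λ p → trans (sym (‖induced‖₀ T S)) (sym (≅ᴹ⇒‖‖₀≡ p)) , ≈.sym p)) (subsets ‖ T ‖) ⟩
  ∑ (subsets ‖ T ‖) (λ S → ⟦ just D ≅ᴹ? induced T S ⟧)   ≡⟨ ∑-map (induced T) _ (subsets ‖ T ‖) ⟨
  copies (just D) (just T)                               ∎
  where
  open ≡-Reasoning
  module ≈ = IsEquivalence ≅ᴹ-isEquivalence

copies≤C : ∀ B T → copies B T ≤ ‖ T ‖₀ C ‖ B ‖₀
copies≤C B T = ≤-trans
  (∑-mono-≤ (λ u → ⟦⟧-mono (B ≅ᴹ? u) (‖ B ‖₀ ≟ ‖ u ‖₀) ≅ᴹ⇒‖‖₀≡) (inducedTrees T))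
  (≤-reflexive (∑-inducedTrees-‖‖ T ‖ B ‖₀))

-- Leaf sets of a tree as tuples over its padded branches.

padded : ℕ → List Tree → List Tree₀
padded d ts = toList (pad d ts)

length-padded : ∀ d ts → length (padded d ts) ≡ d
length-padded zero    ts       = refl
length-padded (suc d) []       = cong suc (length-padded d [])
length-padded (suc d) (t ∷ ts) = cong suc (length-padded d ts)

catMaybes-padded : ∀ {d} ts → length ts ≤ d → catMaybes (padded d ts) ≡ ts
catMaybes-padded {zero}  []       z≤n     = refl
catMaybes-padded {suc d} []       le      = catMaybes-padded {d} [] z≤n
catMaybes-padded {suc d} (t ∷ ts) (s≤s le) = cong (t ∷_) (catMaybes-padded ts le)

-- The number of empty entries is `length us` minus `length (catMaybes us)`; the negative term is
-- moved to the other side.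
∑-catMaybes : ∀ (h : Tree₀ → ℕ) us →
              ∑ us h + length (catMaybes us) * h nothing ≡ ∑ (catMaybes us) (h ∘ just) + length us * h nothing
∑-catMaybes h []             = refl
∑-catMaybes h (nothing ∷ us) = begin
  h nothing + ∑ us h + length (catMaybes us) * h nothing   ≡⟨ +-assoc (h nothing) _ _ ⟩
  h nothing + (∑ us h + length (catMaybes us) * h nothing) ≡⟨ cong (h nothing +_) (∑-catMaybes h us) ⟩
  h nothing + (∑ (catMaybes us) (h ∘ just) + length us * h nothing)
    ≡⟨ m+[n+o]≡n+[m+o] (h nothing) (∑ (catMaybes us) (h ∘ just)) (length us * h nothing) ⟩
  ∑ (catMaybes us) (h ∘ just) + (h nothing + length us * h nothing) ∎
  where open ≡-Reasoning
∑-catMaybes h (just t ∷ us)  = begin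
  h (just t) + ∑ us h + (h nothing + length (catMaybes us) * h nothing)
    ≡⟨ +-assoc (h (just t)) _ _ ⟩
  h (just t) + (∑ us h + (h nothing + length (catMaybes us) * h nothing))
    ≡⟨ cong (h (just t) +_) (m+[n+o]≡n+[m+o] (∑ us h) (h nothing) _) ⟩
  h (just t) + (h nothing + (∑ us h + length (catMaybes us) * h nothing))
    ≡⟨ cong (λ z → h (just t) + (h nothing + z)) (∑-catMaybes h us) ⟩
  h (just t) + (h nothing + (∑ (catMaybes us) (h ∘ just) + length us * h nothing))
    ≡⟨ cong (h (just t) +_) (m+[n+o]≡n+[m+o] (h nothing) (∑ (catMaybes us) (h ∘ just)) (length us * h nothing)) ⟩
  h (just t) + (∑ (catMaybes us) (h ∘ just) + (h nothing + length us * h nothing))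
    ≡⟨ +-assoc (h (just t)) _ _ ⟨
  h (just t) + ∑ (catMaybes us) (h ∘ just) + (h nothing + length us * h nothing) ∎
  where open ≡-Reasoning

≅*⇒∑≡ : ∀ (h : Tree₀ → ℕ) → (∀ {B B′} → B ≅ᴹ B′ → h B ≡ h B′) → ∀ us vs →
        length us ≡ length vs → catMaybes us ≅* catMaybes vs → ∑ us h ≡ ∑ vs h
≅*⇒∑≡ h h-cong us vs l p = +-cancelʳ-≡ (length (catMaybes us) * h nothing) _ _ (begin
  ∑ us h + length (catMaybes us) * h nothing        ≡⟨ ∑-catMaybes h us ⟩
  ∑ (catMaybes us) (h ∘ just) + length us * h nothing
    ≡⟨ cong₂ _+_ (≅*-∑ (h ∘ just) (h-cong ∘ Pointwise.just) p) (cong (_* h nothing) l) ⟩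
  ∑ (catMaybes vs) (h ∘ just) + length vs * h nothing ≡⟨ ∑-catMaybes h vs ⟨
  ∑ vs h + length (catMaybes vs) * h nothing        ≡⟨ cong (λ n → ∑ vs h + n * h nothing) lengths ⟨
  ∑ vs h + length (catMaybes us) * h nothing        ∎)
  where
  open ≡-Reasoning
  length≡∑ : (ts : List Tree) → ∑ ts (λ _ → 1) ≡ length ts
  length≡∑ ts = trans (∑-const 1 ts) (*-identityʳ _)
  lengths : length (catMaybes us) ≡ length (catMaybes vs)
  lengths = trans (sym (length≡∑ (catMaybes us)))
              (trans (≅*-∑ (λ _ → 1) (λ _ → refl) p) (length≡∑ (catMaybes vs)))

-- A leaf set of the forest is a tuple of leaf sets, one per branch; `catMaybes` drops the branches
-- that it misses.
∑-induced* : ∀ {d} ts → length ts ≤ d → (F : List Tree → ℕ) →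
             ∑ (subsets ‖ ts ‖*) (λ S → F (induced* ts S)) ≡
             ∑ˣ (List.map inducedTrees (padded d ts)) (F ∘ catMaybes)
∑-induced* {zero}  []       le       F = +-identityʳ _
∑-induced* {suc d} []       le       F = trans (∑-induced* {d} [] z≤n F) (sym (+-identityʳ _))
∑-induced* {suc d} (t ∷ ts) (s≤s le) F = begin
  _ ≡⟨ ∑-subsets-+ ‖ t ‖ ‖ ts ‖* (λ S₁ S₂ → F (fromMaybe (induced t S₁) ++ induced* ts S₂)) ⟩
  ∑ (subsets ‖ t ‖) (λ S₁ → ∑ (subsets ‖ ts ‖*) λ S₂ → F (fromMaybe (induced t S₁) ++ induced* ts S₂))
    ≡⟨ ∑-map (induced t) (λ u → ∑ (subsets ‖ ts ‖*) λ S₂ → F (fromMaybe u ++ induced* ts S₂)) (subsets ‖ t ‖) ⟨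
  ∑ (inducedTrees (just t)) (λ u → ∑ (subsets ‖ ts ‖*) λ S₂ → F (fromMaybe u ++ induced* ts S₂))
    ≡⟨ ∑-cong (λ u → trans (∑-induced* ts le (λ us → F (fromMaybe u ++ us))) (∑ˣ-cong Ps λ us _ → cong F (shift u us))) (inducedTrees (just t)) ⟩
  ∑ˣ (List.map inducedTrees (padded (suc d) (t ∷ ts))) (F ∘ catMaybes) ∎
  where
  open ≡-Reasoning
  Ps = List.map inducedTrees (padded d ts)
  shift : ∀ u us → fromMaybe u ++ catMaybes us ≡ catMaybes (u ∷ us)
  shift nothing  us = refl
  shift (just _) us = refl

-- Leaf sets contained in a single branch.

isNothing : Tree₀ → ℕ
isNothing nothing  = 1
isNothing (just _) = 0

allNothing : List Tree₀ → ℕ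
allNothing []       = 1
allNothing (u ∷ us) = isNothing u * allNothing us

-- Equals `h t` if `t` is the only nonempty entry; it is 0 if no entry or more than one is nonempty.
single : (Tree → ℕ) → List Tree₀ → ℕ
single h []             = 0
single h (nothing ∷ us) = single h us
single h (just t  ∷ us) = h t * allNothing us

∑-isNothing : ∀ T → ∑ (inducedTrees T) isNothing ≡ 1
∑-isNothing T = trans (∑-cong eq (inducedTrees T)) (∑-inducedTrees-‖‖ T 0)
  where
  eq : ∀ u → isNothing u ≡ ⟦ 0 ≟ ‖ u ‖₀ ⟧
  eq nothing  = refl
  eq (just t) = sym (⟦⟧-false (0 ≟ ‖ t ‖) (<⇒≢ (‖t‖>0 t)))

∑ˣ-allNothing : ∀ Ts → ∑ˣ (List.map inducedTrees Ts) allNothing ≡ 1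
∑ˣ-allNothing []       = refl
∑ˣ-allNothing (T ∷ Ts) = begin
  ∑ (inducedTrees T) (λ u → ∑ˣ Ps (λ us → isNothing u * allNothing us))
    ≡⟨ ∑-cong (λ u → trans (∑ˣ-* (isNothing u) Ps allNothing) (cong (isNothing u *_) (∑ˣ-allNothing Ts))) (inducedTrees T) ⟩
  ∑ (inducedTrees T) (λ u → isNothing u * 1)
    ≡⟨ ∑-cong (λ u → *-identityʳ (isNothing u)) (inducedTrees T) ⟩
  ∑ (inducedTrees T) isNothing ≡⟨ ∑-isNothing T ⟩
  1 ∎
  where
  open ≡-Reasoning
  Ps = List.map inducedTrees Ts

∑ˣ-single : ∀ h Ts → ∑ˣ (List.map inducedTrees Ts) (single h) ≡ ∑ Ts (λ T → ∑ (inducedTrees T) (maybe′ h 0))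
∑ˣ-single h []       = refl
∑ˣ-single h (T ∷ Ts) = begin
  ∑ (inducedTrees T) (λ u → ∑ˣ Ps (λ us → single h (u ∷ us)))
    ≡⟨ ∑-cong split (inducedTrees T) ⟩
  ∑ (inducedTrees T) (λ u → maybe′ h 0 u + isNothing u * ∑ˣ Ps (single h))
    ≡⟨ ∑-distrib-+ (maybe′ h 0) _ (inducedTrees T) ⟩
  H + ∑ (inducedTrees T) (λ u → isNothing u * ∑ˣ Ps (single h))
    ≡⟨ cong (H +_) (*-distribʳ-∑ (∑ˣ Ps (single h)) isNothing (inducedTrees T)) ⟩
  H + ∑ (inducedTrees T) isNothing * ∑ˣ Ps (single h)
    ≡⟨ cong (λ z → H + z * ∑ˣ Ps (single h)) (∑-isNothing T) ⟩
  H + 1 * ∑ˣ Ps (single h)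
    ≡⟨ cong (H +_) (trans (*-identityˡ _) (∑ˣ-single h Ts)) ⟩
  H + ∑ Ts (λ T → ∑ (inducedTrees T) (maybe′ h 0)) ∎
  where
  open ≡-Reasoning
  Ps = List.map inducedTrees Ts
  H = ∑ (inducedTrees T) (maybe′ h 0)
  split : ∀ u → ∑ˣ Ps (λ us → single h (u ∷ us)) ≡ maybe′ h 0 u + isNothing u * ∑ˣ Ps (single h)
  split nothing  = sym (*-identityˡ _)
  split (just t) = trans (∑ˣ-* (h t) Ps allNothing)
    (trans (cong (h t *_) (∑ˣ-allNothing Ts)) (trans (*-identityʳ (h t)) (sym (+-identityʳ (h t)))))

∑-padded : ∀ {d} (g : Tree₀ → ℕ) → g nothing ≡ 0 → ∀ ts → length ts ≤ d → ∑ (padded d ts) g ≡ ∑ ts (g ∘ just)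
∑-padded {zero}  g g0 []       le       = refl
∑-padded {suc d} g g0 []       le       = cong₂ _+_ g0 (∑-padded {d} g g0 [] z≤n)
∑-padded {suc d} g g0 (t ∷ ts) (s≤s le) = cong (g (just t) +_) (∑-padded g g0 ts le)

allNothing-catMaybes : ∀ us → catMaybes us ≡ [] → allNothing us ≡ 1
allNothing-catMaybes []             e = refl
allNothing-catMaybes (nothing ∷ us) e = trans (*-identityˡ _) (allNothing-catMaybes us e)

single-catMaybes : ∀ h us {t} → catMaybes us ≡ t ∷ [] → single h us ≡ h t
single-catMaybes h (nothing ∷ us) e    = single-catMaybes h us e
single-catMaybes h (just t ∷ us)  e    with ∷-injective e
... | refl , e′ = trans (cong (h t *_) (allNothing-catMaybes us e′)) (*-identityʳ (h t))

allNothing-∷ : ∀ us {t ts} → catMaybes us ≡ t ∷ ts → allNothing us ≡ 0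
allNothing-∷ (nothing ∷ us) e = trans (*-identityˡ _) (allNothing-∷ us e)
allNothing-∷ (just t ∷ us)  e = refl

single-≥2 : ∀ h us → 2 ≤ length (catMaybes us) → single h us ≡ 0
single-≥2 h (nothing ∷ us) le = single-≥2 h us le
single-≥2 h (just t ∷ us)  (s≤s le) with catMaybes us in eq
... | _ ∷ _ = trans (cong (h t *_) (allNothing-∷ us eq)) (*-zeroʳ (h t))

-- The two inequalities at a vertex, with G = `Iso.Φ Bs` and H = `Size.Φ Bs`.

module Iso  = Classes _≅ᴹ?_ ≅ᴹ-isEquivalence
module Size = Classes (λ B B′ → ‖ B ‖₀ ≟ ‖ B′ ‖₀) (On.isEquivalence ‖_‖₀ isEquivalence)

sizeC : Tree₀ → Tree₀ → ℕ
sizeC B T = ‖ T ‖₀ C ‖ B ‖₀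

length>0⇒‖‖*>0 : ∀ ts → 0 < length ts → 0 < ‖ ts ‖*
length>0⇒‖‖*>0 (t ∷ ts) _ = ≤-trans (‖t‖>0 t) (m≤m+n _ _)

∑-‖‖₀ : ∀ us → ∑ us ‖_‖₀ ≡ ‖ catMaybes us ‖*
∑-‖‖₀ []             = refl
∑-‖‖₀ (nothing ∷ us) = ∑-‖‖₀ us
∑-‖‖₀ (just t ∷ us)  = cong (‖ t ‖ +_) (∑-‖‖₀ us)

length-catMaybes : (us : List Tree₀) → length (catMaybes us) ≡ ∑ us (maybe′ (λ _ → 1) 0)
length-catMaybes []             = refl
length-catMaybes (nothing ∷ us) = length-catMaybes us
length-catMaybes (just t ∷ us)  = cong suc (length-catMaybes us)

‖‖₀-detects-nothing : ∀ B u → ‖ B ‖₀ ≡ ‖ u ‖₀ → maybe′ (λ _ → 1) 0 B ≡ maybe′ (λ (_ : Tree) → 1) 0 u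
‖‖₀-detects-nothing nothing  nothing  e = refl
‖‖₀-detects-nothing nothing  (just t) e = contradiction e (<⇒≢ (‖t‖>0 t))
‖‖₀-detects-nothing (just t) nothing  e = contradiction (sym e) (<⇒≢ (‖t‖>0 t))
‖‖₀-detects-nothing (just _) (just _) e = refl

module Root {d : ℕ} (ds : List Tree) (2≤ds : 2 ≤ length ds) (ds≤d : length ds ≤ d) where

  Bs : List Tree₀
  Bs = padded d ds

  D : Tree
  D = node ds

  k : ℕ
  k = ‖ ds ‖*

  ∑-Bs : ∑ Bs ‖_‖₀ ≡ k
  ∑-Bs = trans (∑-‖‖₀ Bs) (cong ‖_‖* (catMaybes-padded ds ds≤d))

  private
    copy : Tree → ℕ
    copy t = ⟦ just D ≅ᴹ? just t ⟧

    sized : Tree → ℕ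
    sized t = ⟦ k ≟ ‖ t ‖ ⟧

  -- The cases are the number of nonempty entries. With none, nothing is induced; with one, the copy
  -- lies in a single branch; with more, `D` is induced only if the entries match its branches, and
  -- then the permanent is G.
  join-bound : ∀ us → length us ≡ d →
               Iso.Φ Bs * ⟦ just D ≅ᴹ? join (catMaybes us) ⟧ ≤ Iso.Φ Bs * single copy us + per Iso.δ Bs us
  join-bound us l with catMaybes us in eq
  ... | []         = ≤-trans (≤-reflexive (*-zeroʳ (Iso.Φ Bs))) z≤n
  ... | t ∷ []     = ≤-trans (≤-reflexive (cong (Iso.Φ Bs *_) (sym (single-catMaybes copy us eq)))) (m≤m+n _ _)
  ... | t ∷ u ∷ ts with just D ≅ᴹ? just (node (t ∷ u ∷ ts))
  ...   | no  _ = ≤-trans (≤-reflexive (*-zeroʳ (Iso.Φ Bs))) z≤n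
  ...   | yes (Pointwise.just (iso p)) = ≤-trans (≤-reflexive (trans (*-identityʳ _) (sym matched))) (m≤n+m _ _)
    where
    matched : per Iso.δ Bs us ≡ Iso.Φ Bs
    matched = Iso.per-matched Bs us λ x →
      ≅*⇒∑≡ (Iso.δ x) (Iso.δ-cong x) Bs us (trans (length-padded d ds) (sym l))
        (subst₂ _≅*_ (sym (catMaybes-padded ds ds≤d)) (sym eq) p)

  copies-bound : ∀ t ts → length (t ∷ ts) ≤ d →
    Iso.Φ Bs * copies (just D) (just (node (t ∷ ts))) ≤
    Iso.Φ Bs * ∑ (t ∷ ts) (copies (just D) ∘ just) + per copies Bs (padded d (t ∷ ts))
  copies-bound t ts le = begin
    Iso.Φ Bs * copies (just D) (just (node (t ∷ ts)))
      ≡⟨ cong (Iso.Φ Bs *_) (trans (∑-map (induced (node (t ∷ ts))) _ (subsets ‖ t ∷ ts ‖*))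
                                   (∑-induced* (t ∷ ts) le (λ us → ⟦ just D ≅ᴹ? join us ⟧))) ⟩
    Iso.Φ Bs * ∑ˣ Ps (λ us → ⟦ just D ≅ᴹ? join (catMaybes us) ⟧)
      ≡⟨ ∑ˣ-* (Iso.Φ Bs) Ps _ ⟨
    ∑ˣ Ps (λ us → Iso.Φ Bs * ⟦ just D ≅ᴹ? join (catMaybes us) ⟧)
      ≤⟨ ∑ˣ-mono-≤ Ps (λ us l → join-bound us (trans l (trans (length-map inducedTrees Ts) (length-padded d (t ∷ ts))))) ⟩
    ∑ˣ Ps (λ us → Iso.Φ Bs * single copy us + per Iso.δ Bs us)
      ≡⟨ ∑ˣ-+ Ps _ _ ⟩
    ∑ˣ Ps (λ us → Iso.Φ Bs * single copy us) + ∑ˣ Ps (per Iso.δ Bs)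
      ≡⟨ cong₂ _+_ (∑ˣ-* (Iso.Φ Bs) Ps (single copy)) (trans (∑ˣ-per Iso.δ Bs Ps) (per-map _ inducedTrees Bs Ts)) ⟩
    Iso.Φ Bs * ∑ˣ Ps (single copy) + per copies Bs Ts
      ≡⟨ cong (λ z → Iso.Φ Bs * z + per copies Bs Ts) (trans (∑ˣ-single copy Ts) (trans (∑-cong one Ts)
           (∑-padded (copies (just D)) refl (t ∷ ts) le))) ⟩
    Iso.Φ Bs * ∑ (t ∷ ts) (copies (just D) ∘ just) + per copies Bs Ts ∎
    where
    open ≤-Reasoning
    Ts = padded d (t ∷ ts)
    Ps = List.map inducedTrees Ts
    one : ∀ T → ∑ (inducedTrees T) (maybe′ copy 0) ≡ copies (just D) T
    one T = ∑-cong (λ { nothing → refl ; (just _) → refl }) (inducedTrees T)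

  single-sized≤ : ∀ us → single sized us ≤ ⟦ k ≟ ‖ catMaybes us ‖* ⟧
  single-sized≤ []             = z≤n
  single-sized≤ (nothing ∷ us) = single-sized≤ us
  single-sized≤ (just t ∷ us)  with catMaybes us in eq
  ... | u ∷ ts = ≤-trans (≤-reflexive (trans (cong (sized t *_) (allNothing-∷ us eq)) (*-zeroʳ (sized t)))) z≤n
  ... | []     = ≤-reflexive (trans (cong (sized t *_) (allNothing-catMaybes us eq))
                   (trans (*-identityʳ _) (cong (λ n → ⟦ k ≟ n ⟧) (sym (+-identityʳ ‖ t ‖)))))

  -- The terms on the left are never nonzero together: a nonzero permanent matches the sizes with
  -- those of the branches of `D`, at least two of which are nonempty, while `single` asks for
  -- exactly one nonempty entry.
  Vandermonde-point : ∀ us → per Size.δ Bs us + Size.Φ Bs * single sized us ≤ Size.Φ Bs * ⟦ k ≟ ‖ catMaybes us ‖* ⟧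
  Vandermonde-point us with per Size.δ Bs us ≟ 0
  ... | yes e = ≤-trans (≤-reflexive (cong (_+ Size.Φ Bs * single sized us) e)) (*-monoʳ-≤ (Size.Φ Bs) (single-sized≤ us))
  ... | no ne = ≤-reflexive (begin
    per Size.δ Bs us + Size.Φ Bs * single sized us
      ≡⟨ cong₂ _+_ (Size.per-matched Bs us (Size.per≢0⇒matched Bs us ne))
           (trans (cong (Size.Φ Bs *_) (single-≥2 sized us (subst (2 ≤_) lengths 2≤ds))) (*-zeroʳ (Size.Φ Bs))) ⟩
    Size.Φ Bs + 0                          ≡⟨ trans (+-identityʳ _) (sym (*-identityʳ _)) ⟩
    Size.Φ Bs * 1
      ≡⟨ cong (Size.Φ Bs *_) (⟦⟧-true (k ≟ ‖ catMaybes us ‖*) total) ⟨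
    Size.Φ Bs * ⟦ k ≟ ‖ catMaybes us ‖* ⟧  ∎)
    where
    open ≡-Reasoning
    total : k ≡ ‖ catMaybes us ‖*
    total = trans (sym ∑-Bs) (trans
      (per≢0⇒∑≡ (λ B u ne → ⟦⟧≢0 (‖ B ‖₀ ≟ ‖ u ‖₀) ne) Bs us ne) (∑-‖‖₀ us))
    lengths : length ds ≡ length (catMaybes us)
    lengths = trans (cong length (sym (catMaybes-padded ds ds≤d))) (trans (length-catMaybes Bs) (trans
      (per≢0⇒∑≡ (λ B u ne → ‖‖₀-detects-nothing B u (⟦⟧≢0 (‖ B ‖₀ ≟ ‖ u ‖₀) ne)) Bs us ne)
      (sym (length-catMaybes us))))

  Vandermonde : ∀ ts → length ts ≤ d →
    per sizeC Bs (padded d ts) + Size.Φ Bs * ∑ ts (λ t → ‖ t ‖ C k) ≤ Size.Φ Bs * (‖ ts ‖* C k)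
  Vandermonde ts le = begin
    per sizeC Bs Ts + Size.Φ Bs * ∑ ts (λ t → ‖ t ‖ C k)
      ≡⟨ cong₂ (λ y z → y + Size.Φ Bs * z)
           (trans (trans (∑ˣ-per Size.δ Bs Ps) (per-map _ inducedTrees Bs Ts)) (per-cong (λ B T → ∑-inducedTrees-‖‖ T ‖ B ‖₀) Bs Ts))
           (trans (trans (∑ˣ-single sized Ts) (∑-cong one Ts)) (∑-padded (λ T → ‖ T ‖₀ C k) (k>n⇒nCk≡0 0<k) ts le)) ⟨
    ∑ˣ Ps (per Size.δ Bs) + Size.Φ Bs * ∑ˣ Ps (single sized)
      ≡⟨ cong (∑ˣ Ps (per Size.δ Bs) +_) (∑ˣ-* (Size.Φ Bs) Ps (single sized)) ⟨
    ∑ˣ Ps (per Size.δ Bs) + ∑ˣ Ps (λ us → Size.Φ Bs * single sized us)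
      ≡⟨ ∑ˣ-+ Ps _ _ ⟨
    ∑ˣ Ps (λ us → per Size.δ Bs us + Size.Φ Bs * single sized us)
      ≤⟨ ∑ˣ-mono-≤ Ps (λ us _ → Vandermonde-point us) ⟩
    ∑ˣ Ps (λ us → Size.Φ Bs * ⟦ k ≟ ‖ catMaybes us ‖* ⟧)
      ≡⟨ ∑ˣ-* (Size.Φ Bs) Ps _ ⟩
    Size.Φ Bs * ∑ˣ Ps (λ us → ⟦ k ≟ ‖ catMaybes us ‖* ⟧)
      ≡⟨ cong (Size.Φ Bs *_) (∑-induced* ts le (λ us → ⟦ k ≟ ‖ us ‖* ⟧)) ⟨
    Size.Φ Bs * ∑ (subsets ‖ ts ‖*) (λ S → ⟦ k ≟ ‖ induced* ts S ‖* ⟧)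
      ≡⟨ cong (Size.Φ Bs *_) (trans (∑-cong (λ S → cong (λ n → ⟦ k ≟ n ⟧) (‖induced*‖* ts S)) (subsets ‖ ts ‖*)) (∑-subsets-∣∣ ‖ ts ‖* k)) ⟩
    Size.Φ Bs * (‖ ts ‖* C k) ∎
    where
    open ≤-Reasoning
    Ts = padded d ts
    Ps = List.map inducedTrees Ts
    0<k : 0 < k
    0<k = length>0⇒‖‖*>0 ds (≤-trans (s≤s z≤n) 2≤ds)
    one : ∀ T → ∑ (inducedTrees T) (maybe′ sized 0) ≡ ‖ T ‖₀ C k
    one T = trans (∑-cong (λ { nothing → sym (⟦⟧-false (k ≟ 0) (λ e → <⇒≢ 0<k (sym e))) ; (just _) → refl }) (inducedTrees T))
                  (∑-inducedTrees-‖‖ T k)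

-- Estimates with error terms for entries and permanents.

nCk≤n^k : ∀ n k → n C k ≤ n ^ k
nCk≤n^k n       zero    = ≤-refl
nCk≤n^k zero    (suc k) = z≤n
nCk≤n^k (suc n) (suc k) = begin
  suc n C suc k        ≡⟨ nCk+nC[k+1]≡[n+1]C[k+1] n k ⟨
  n C k + n C suc k    ≤⟨ +-mono-≤ (nCk≤n^k n k) (nCk≤n^k n (suc k)) ⟩
  suc n * n ^ k        ≤⟨ *-monoʳ-≤ (suc n) (^-monoˡ-≤ k (n≤1+n n)) ⟩
  suc n * suc n ^ k    ∎
  where open ≤-Reasoning

-- copies B T is at most (p / q) · (‖ T ‖ C ‖ B ‖) up to a bounded error, which
-- vanishes if ‖ B ‖ < 2: hence the comparison with m ^ ‖ B ‖ / m².
Estimate : ℕ → Tree₀ → ℕ → ℕ → Set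
Estimate d B p q = ∃ λ b → ∀ T → Maybe.All (IsDary d) T → ∀ m → 1 ≤ m →
  m * m * (q * copies B T) ≤ m * m * (p * sizeC B T) + b * m ^ ‖ B ‖₀

data Estimates (d : ℕ) : List Tree₀ → ℕ → ℕ → Set where
  []  : Estimates d [] 1 1
  _∷_ : ∀ {B Bs p q P Q} → Estimate d B p q → Estimates d Bs P Q → Estimates d (B ∷ Bs) (p * P) (q * Q)

module _ {d : ℕ} where

  Small : ℕ → Tree₀ → Set
  Small m T = Maybe.All (IsDary d) T × ‖ T ‖₀ ≤ m

  sizeC≤ : ∀ B {m T} → Small m T → sizeC B T ≤ m ^ ‖ B ‖₀
  sizeC≤ B {m} {T} (_ , le) = ≤-trans (nCk≤n^k ‖ T ‖₀ ‖ B ‖₀) (^-monoˡ-≤ ‖ B ‖₀ le)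

  ∑ᴾ-≤ : ∀ {A : Set} {L c} (g h : A → List A → ℕ) xs → length xs ≤ L →
         (∀ {x ys} → Pick x xs ys → g x ys ≤ h x ys + c) → ∑ᴾ g xs ≤ ∑ᴾ h xs + L * c
  ∑ᴾ-≤ {L = L} {c} g h xs l le = begin
    ∑ᴾ g xs                              ≤⟨ ∑ᴾ-mono-≤ xs le ⟩
    ∑ᴾ (λ x ys → h x ys + c) xs          ≡⟨ ∑ᴾ-+ h (λ _ _ → c) xs ⟩
    ∑ᴾ h xs + ∑ᴾ (λ _ _ → c) xs          ≡⟨ cong (∑ᴾ h xs +_) (∑ᴾ-const c xs) ⟩
    ∑ᴾ h xs + length xs * c              ≤⟨ +-monoʳ-≤ (∑ᴾ h xs) (*-monoˡ-≤ c l) ⟩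
    ∑ᴾ h xs + L * c                      ∎
    where open ≤-Reasoning

  -- A crude bound for the minors, used where a minor multiplies the error of an entry.
  per-copies≤ : ∀ {Bs P Q} → Estimates d Bs P Q → ∀ L → ∃ λ F → ∀ m Ts → 1 ≤ m → length Ts ≤ L →
                All (Small m) Ts → Q * per copies Bs Ts ≤ F * m ^ ∑ Bs ‖_‖₀
  per-copies≤ [] L = 1 , λ { m [] _ _ _ → ≤-refl ; m (_ ∷ _) _ _ _ → z≤n }
  per-copies≤ {B ∷ Bs} (_∷_ {p = p} {q} {P} {Q} (b , est) ests) L = L * ((p + b) * F) , bound
    where
    F = proj₁ (per-copies≤ ests L)
    IH = proj₂ (per-copies≤ ests L)
    K = ∑ Bs ‖_‖₀
    open ≤-Reasoning
    bound : ∀ m Ts → 1 ≤ m → length Ts ≤ L → All (Small m) Ts →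
            q * Q * per copies (B ∷ Bs) Ts ≤ L * ((p + b) * F) * m ^ (‖ B ‖₀ + K)
    bound m@(suc _) Ts 1≤m l small = begin
      q * Q * per copies (B ∷ Bs) Ts ≡⟨ ∑ᴾ-* (q * Q) _ Ts ⟨
      ∑ᴾ (λ T Ts′ → q * Q * (copies B T * per copies Bs Ts′)) Ts ≤⟨ ∑ᴾ-≤ _ (λ _ _ → 0) Ts l step ⟩
      ∑ᴾ (λ _ _ → 0) Ts + L * ((p + b) * m ^ ‖ B ‖₀ * (F * m ^ K))
        ≡⟨ cong (_+ L * ((p + b) * m ^ ‖ B ‖₀ * (F * m ^ K))) (trans (∑ᴾ-const 0 Ts) (*-zeroʳ (length Ts))) ⟩
      L * ((p + b) * m ^ ‖ B ‖₀ * (F * m ^ K)) ≡⟨ shuffle L (p + b) (m ^ ‖ B ‖₀) F (m ^ K) ⟩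
      L * ((p + b) * F) * (m ^ ‖ B ‖₀ * m ^ K)
        ≡⟨ cong (L * ((p + b) * F) *_) (^-distribˡ-+-* m ‖ B ‖₀ K) ⟨
      L * ((p + b) * F) * m ^ (‖ B ‖₀ + K) ∎
      where
      shuffle : ∀ L s x F y → L * (s * x * (F * y)) ≡ L * (s * F) * (x * y)
      shuffle = solve-∀
      entry : ∀ {T} → Small m T → q * copies B T ≤ (p + b) * m ^ ‖ B ‖₀
      entry {T} sm = *-cancelˡ-≤ (m * m) (begin
        m * m * (q * copies B T)                      ≤⟨ est T (proj₁ sm) m 1≤m ⟩
        m * m * (p * sizeC B T) + b * m ^ ‖ B ‖₀
          ≤⟨ +-mono-≤ (*-monoʳ-≤ (m * m) (*-monoʳ-≤ p (sizeC≤ B sm))) (m≤n*m (b * m ^ ‖ B ‖₀) (m * m)) ⟩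
        m * m * (p * m ^ ‖ B ‖₀) + m * m * (b * m ^ ‖ B ‖₀) ≡⟨ *-distribˡ-+ (m * m) (p * m ^ ‖ B ‖₀) _ ⟨
        m * m * (p * m ^ ‖ B ‖₀ + b * m ^ ‖ B ‖₀)
          ≡⟨ cong (m * m *_) (*-distribʳ-+ (m ^ ‖ B ‖₀) p b) ⟨
        m * m * ((p + b) * m ^ ‖ B ‖₀)                ∎)
      step : ∀ {T Ts′} → Pick T Ts Ts′ → q * Q * (copies B T * per copies Bs Ts′) ≤ 0 + (p + b) * m ^ ‖ B ‖₀ * (F * m ^ K)
      step {T} {Ts′} pk = begin
        q * Q * (copies B T * per copies Bs Ts′)     ≡⟨ *-interchange q Q (copies B T) _ ⟩
        q * copies B T * (Q * per copies Bs Ts′)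
          ≤⟨ *-mono-≤ (entry (proj₁ (All-pick pk small)))
               (IH m Ts′ 1≤m (≤-trans (n≤1+n _) (≤-trans (≤-reflexive (sym (length-pick pk))) l)) (proj₂ (All-pick pk small))) ⟩
        (p + b) * m ^ ‖ B ‖₀ * (F * m ^ K)           ∎

  -- Expansion along the first row, one factor replaced at a time. The error `b` of the entry meets
  -- the crude bound `F` of the minor, and the error `E` of the minor meets the main part of the
  -- entry, at most `p * m ^ ‖ B ‖₀`; there are at most `L` terms.
  per-copies≤per-sizeC : ∀ {Bs P Q} → Estimates d Bs P Q → ∀ L → ∃ λ E → ∀ m Ts → 1 ≤ m → length Ts ≤ L →
    All (Small m) Ts → m * m * (Q * per copies Bs Ts) ≤ m * m * (P * per sizeC Bs Ts) + E * m ^ ∑ Bs ‖_‖₀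
  per-copies≤per-sizeC [] L = 0 , λ { m [] _ _ _ → m≤m+n _ _ ; m (_ ∷ _) _ _ _ → m≤m+n _ _ }
  per-copies≤per-sizeC {B ∷ Bs} (_∷_ {p = p} {q} {P} {Q} (b , est) ests) L = L * (p * E + b * F) , bound
    where
    F = proj₁ (per-copies≤ ests L)
    F-bound = proj₂ (per-copies≤ ests L)
    E = proj₁ (per-copies≤per-sizeC ests L)
    IH = proj₂ (per-copies≤per-sizeC ests L)
    K = ∑ Bs ‖_‖₀
    open ≤-Reasoning
    bound : ∀ m Ts → 1 ≤ m → length Ts ≤ L → All (Small m) Ts →
            m * m * (q * Q * per copies (B ∷ Bs) Ts) ≤
            m * m * (p * P * per sizeC (B ∷ Bs) Ts) + L * (p * E + b * F) * m ^ (‖ B ‖₀ + K)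
    bound m Ts 1≤m l small = begin
      m * m * (q * Q * per copies (B ∷ Bs) Ts)
        ≡⟨ *-assoc (m * m) (q * Q) _ ⟨
      m * m * (q * Q) * per copies (B ∷ Bs) Ts
        ≡⟨ ∑ᴾ-* (m * m * (q * Q)) _ Ts ⟨
      ∑ᴾ (λ T Ts′ → m * m * (q * Q) * (copies B T * per copies Bs Ts′)) Ts
        ≤⟨ ∑ᴾ-≤ _ (λ T Ts′ → m * m * (p * P) * (sizeC B T * per sizeC Bs Ts′)) Ts l step ⟩
      ∑ᴾ (λ T Ts′ → m * m * (p * P) * (sizeC B T * per sizeC Bs Ts′)) Ts + L * ((p * E + b * F) * (x * y))
        ≡⟨ cong₂ _+_ (trans (∑ᴾ-* (m * m * (p * P)) _ Ts) (*-assoc (m * m) (p * P) _))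
             (trans (sym (*-assoc L (p * E + b * F) (x * y))) (cong (L * (p * E + b * F) *_) (sym (^-distribˡ-+-* m ‖ B ‖₀ K)))) ⟩
      m * m * (p * P * per sizeC (B ∷ Bs) Ts) + L * (p * E + b * F) * m ^ (‖ B ‖₀ + K) ∎
      where
      x = m ^ ‖ B ‖₀
      y = m ^ K
      shuffle₁ : ∀ M q Q c w → M * (q * Q) * (c * w) ≡ M * (q * c) * (Q * w)
      shuffle₁ = solve-∀
      shuffle₂ : ∀ M p X b x W → (M * (p * X) + b * x) * W ≡ p * X * (M * W) + b * x * W
      shuffle₂ = solve-∀
      shuffle₃ : ∀ M p X P V E y b x F →
                 p * X * (M * (P * V) + E * y) + b * x * (F * y) ≡ M * (p * P) * (X * V) + (p * E * y * X + b * F * (x * y))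
      shuffle₃ = solve-∀
      shuffle₄ : ∀ p E y x b F → p * E * y * x + b * F * (x * y) ≡ (p * E + b * F) * (x * y)
      shuffle₄ = solve-∀
      step : ∀ {T Ts′} → Pick T Ts Ts′ → m * m * (q * Q) * (copies B T * per copies Bs Ts′) ≤
             m * m * (p * P) * (sizeC B T * per sizeC Bs Ts′) + (p * E + b * F) * (x * y)
      step {T} {Ts′} pk = begin
        m * m * (q * Q) * (copies B T * per copies Bs Ts′)
          ≡⟨ shuffle₁ (m * m) q Q (copies B T) _ ⟩
        m * m * (q * copies B T) * W
          ≤⟨ *-monoˡ-≤ W (est T (proj₁ (proj₁ sm)) m 1≤m) ⟩
        (m * m * (p * X) + b * x) * W
          ≡⟨ shuffle₂ (m * m) p X b x W ⟩
        p * X * (m * m * W) + b * x * W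
          ≤⟨ +-mono-≤ (*-monoʳ-≤ (p * X) (IH m Ts′ 1≤m l′ (proj₂ sm))) (*-monoʳ-≤ (b * x) (F-bound m Ts′ 1≤m l′ (proj₂ sm))) ⟩
        p * X * (m * m * (P * per sizeC Bs Ts′) + E * y) + b * x * (F * y)
          ≡⟨ shuffle₃ (m * m) p X P (per sizeC Bs Ts′) E y b x F ⟩
        m * m * (p * P) * (X * per sizeC Bs Ts′) + (p * E * y * X + b * F * (x * y))
          ≤⟨ +-monoʳ-≤ (m * m * (p * P) * (X * per sizeC Bs Ts′)) (+-monoˡ-≤ (b * F * (x * y)) (*-monoʳ-≤ (p * E * y) (sizeC≤ B (proj₁ sm)))) ⟩
        m * m * (p * P) * (X * per sizeC Bs Ts′) + (p * E * y * x + b * F * (x * y))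
          ≡⟨ cong (m * m * (p * P) * (X * per sizeC Bs Ts′) +_) (shuffle₄ p E y x b F) ⟩
        m * m * (p * P) * (X * per sizeC Bs Ts′) + (p * E + b * F) * (x * y) ∎
        where
        sm = All-pick pk small
        X = sizeC B T
        W = Q * per copies Bs Ts′
        l′ = ≤-trans (n≤1+n _) (≤-trans (≤-reflexive (sym (length-pick pk))) l)

-- Accumulation of the errors over a tree.

-- The potential (n - 1) n^κ of a vertex with n leaves below it exceeds the sum of
-- the potentials of its children by at least n^κ, the error made at that vertex.
excess : ℕ → Tree → ℕ
excess κ t = (‖ t ‖ ∸ 1) * ‖ t ‖ ^ κ

-- A branch with n_i ≤ n leaves satisfies (n_i - 1) n_i^κ + n^κ ≤ n_i n^κ. The bound `n` stays fixed
-- while the list shrinks.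
∑-excess : ∀ κ n ts → ‖ ts ‖* ≤ n → ∑ ts (excess κ) + length ts * n ^ κ ≤ ‖ ts ‖* * n ^ κ
∑-excess κ n []       le = z≤n
∑-excess κ n (t ∷ ts) le = begin
  excess κ t + ∑ ts (excess κ) + (n ^ κ + length ts * n ^ κ)
    ≡⟨ +-interchange (excess κ t) _ _ _ ⟩
  excess κ t + n ^ κ + (∑ ts (excess κ) + length ts * n ^ κ)
    ≤⟨ +-mono-≤ head (∑-excess κ n ts (≤-trans (m≤n+m _ _) le)) ⟩
  ‖ t ‖ * n ^ κ + ‖ ts ‖* * n ^ κ
    ≡⟨ *-distribʳ-+ (n ^ κ) ‖ t ‖ _ ⟨
  (‖ t ‖ + ‖ ts ‖*) * n ^ κ ∎
  where
  open ≤-Reasoning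
  head : excess κ t + n ^ κ ≤ ‖ t ‖ * n ^ κ
  head = begin
    (‖ t ‖ ∸ 1) * ‖ t ‖ ^ κ + n ^ κ
      ≤⟨ +-monoˡ-≤ (n ^ κ) (*-monoʳ-≤ (‖ t ‖ ∸ 1) (^-monoˡ-≤ κ (≤-trans (m≤m+n _ _) le))) ⟩
    (‖ t ‖ ∸ 1) * n ^ κ + n ^ κ     ≡⟨ +-comm _ (n ^ κ) ⟩
    suc (‖ t ‖ ∸ 1) * n ^ κ         ≡⟨ cong (_* n ^ κ) (m+[n∸m]≡n (‖t‖>0 t)) ⟩
    ‖ t ‖ * n ^ κ                   ∎

-- Each branch leaves a surplus n^κ. One surplus makes up for the -1 in the potential of the parent;
-- a second, present because there are at least two branches, pays for the error.
∑-excess-branches : ∀ κ ts → 2 ≤ length ts → ∑ ts (excess κ) + ‖ ts ‖* ^ κ ≤ (‖ ts ‖* ∸ 1) * ‖ ts ‖* ^ κ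
∑-excess-branches κ ts 2≤ = +-cancelʳ-≤ (n ^ κ) _ _ (begin
  ∑ ts (excess κ) + n ^ κ + n ^ κ         ≡⟨ +-assoc (∑ ts (excess κ)) _ _ ⟩
  ∑ ts (excess κ) + (n ^ κ + n ^ κ)
    ≡⟨ cong (λ z → ∑ ts (excess κ) + (n ^ κ + z)) (+-identityʳ (n ^ κ)) ⟨
  ∑ ts (excess κ) + 2 * n ^ κ             ≤⟨ +-monoʳ-≤ (∑ ts (excess κ)) (*-monoˡ-≤ (n ^ κ) 2≤) ⟩
  ∑ ts (excess κ) + length ts * n ^ κ     ≤⟨ ∑-excess κ n ts ≤-refl ⟩
  n * n ^ κ
    ≡⟨ cong (_* n ^ κ) (m+[n∸m]≡n (length>0⇒‖‖*>0 ts (≤-trans (s≤s z≤n) 2≤))) ⟨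
  suc (n ∸ 1) * n ^ κ                     ≡⟨ +-comm (n ^ κ) _ ⟩
  (n ∸ 1) * n ^ κ + n ^ κ                 ∎)
  where
  open ≤-Reasoning
  n = ‖ ts ‖*

All-padded : ∀ {d ts} → All (IsDary d) ts → ∀ e n → ‖ ts ‖* ≤ n → All (Small {d} n) (padded e ts)
All-padded ps       zero    n le = []
All-padded []       (suc e) n le = (nothing , z≤n) ∷ All-padded [] e n z≤n
All-padded (p ∷ ps) (suc e) n le =
  (just p , ≤-trans (m≤m+n _ _) le) ∷ All-padded ps e n (≤-trans (m≤n+m _ _) le)

‖node‖ : ∀ {n ts} → suc n ≤ length ts → ‖ node ts ‖ ≡ ‖ ts ‖*
‖node‖ {ts = _ ∷ _} _ = refl

module Recursion {d : ℕ} (ds : List Tree) (2≤ds : 2 ≤ length ds) (ds≤d : length ds ≤ d)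
                 (κ : ℕ) (k≡2+κ : ‖ ds ‖* ≡ 2 + κ)
                 {P Q : ℕ} (ests : Estimates d (padded d ds) P Q) where

  open Root ds 2≤ds ds≤d

  E : ℕ
  E = proj₁ (per-copies≤per-sizeC ests d)

  -- With m = n, the number of leaves below the vertex, m^k is n² n^κ, so n² cancels.
  per-bound : ∀ {ts} → All (IsDary d) ts → 0 < length ts →
              Q * per copies Bs (padded d ts) ≤ P * per sizeC Bs (padded d ts) + E * ‖ ts ‖* ^ κ
  per-bound {ts} ps 0<ts = *-cancelˡ-≤ (n * n) {{m*n≢0 n n {{>-nonZero 0<n}} {{>-nonZero 0<n}}}} (begin
    n * n * (Q * per copies Bs Ts)
      ≤⟨ proj₂ (per-copies≤per-sizeC ests d) n Ts 0<n (≤-reflexive (length-padded d ts)) (All-padded ps d n ≤-refl) ⟩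
    n * n * (P * per sizeC Bs Ts) + E * n ^ ∑ Bs ‖_‖₀
      ≡⟨ cong (λ z → n * n * (P * per sizeC Bs Ts) + E * n ^ z) (trans ∑-Bs k≡2+κ) ⟩
    n * n * (P * per sizeC Bs Ts) + E * (n * (n * n ^ κ))
      ≡⟨ shuffle n (P * per sizeC Bs Ts) E (n ^ κ) ⟩
    n * n * (P * per sizeC Bs Ts + E * n ^ κ) ∎)
    where
    open ≤-Reasoning
    n = ‖ ts ‖*
    Ts = padded d ts
    0<n = length>0⇒‖‖*>0 ts 0<ts
    shuffle : ∀ n a E x → n * n * a + E * (n * (n * x)) ≡ n * n * (a + E * x)
    shuffle = solve-∀

  G = Iso.Φ Bs
  H = Size.Φ Bs

  mutual
    copies≤ : ∀ {T} → IsDary d T → G * (Q * copies (just D) (just T)) ≤ H * P * (‖ T ‖ C k) + E * excess κ T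
    -- One leaf contains no copy of `D`, as k ≥ 2.
    copies≤ leaf = ≤-trans (≤-reflexive e) z≤n
      where
      e : G * (Q * copies (just D) (just (node []))) ≡ 0
      e rewrite n≤0⇒n≡0 (≤-trans (copies≤C (just D) (just (node [])))
                  (≤-reflexive (k>n⇒nCk≡0 (subst (1 <_) (sym (trans (‖node‖ {ts = ds} 2≤ds) k≡2+κ)) (s≤s (s≤s z≤n))))))
              | *-zeroʳ Q = *-zeroʳ G
    copies≤ (internal {ts@(t ∷ ts′)} 2≤ts ts≤d ps) = begin
      G * (Q * copies (just D) (just (node ts)))
        ≡⟨ m*[n*o]≡n*[m*o] G Q _ ⟩
      Q * (G * copies (just D) (just (node ts)))
        ≤⟨ *-monoʳ-≤ Q (copies-bound t ts′ ts≤d) ⟩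
      Q * (G * S + per copies Bs Ts)
        ≡⟨ shuffle₁ Q G S (per copies Bs Ts) ⟩
      G * (Q * S) + Q * per copies Bs Ts
        ≤⟨ +-mono-≤ (∑-copies≤ ps) (per-bound ps (s≤s z≤n)) ⟩
      H * P * ∑ ts (λ t → ‖ t ‖ C k) + E * ∑ ts (excess κ) + (P * per sizeC Bs Ts + E * ‖ ts ‖* ^ κ)
        ≡⟨ shuffle₂ H P (∑ ts (λ t → ‖ t ‖ C k)) E (∑ ts (excess κ)) (per sizeC Bs Ts) (‖ ts ‖* ^ κ) ⟩
      P * (per sizeC Bs Ts + H * ∑ ts (λ t → ‖ t ‖ C k)) + E * (∑ ts (excess κ) + ‖ ts ‖* ^ κ)
        ≤⟨ +-mono-≤ (*-monoʳ-≤ P (Vandermonde ts ts≤d)) (*-monoʳ-≤ E (∑-excess-branches κ ts 2≤ts)) ⟩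
      P * (H * (‖ ts ‖* C k)) + E * excess κ (node ts)
        ≡⟨ cong (_+ E * excess κ (node ts)) (trans (m*[n*o]≡n*[m*o] P H _) (sym (*-assoc H P _))) ⟩
      H * P * (‖ ts ‖* C k) + E * excess κ (node ts) ∎
      where
      open ≤-Reasoning
      Ts = padded d ts
      S = ∑ ts (copies (just D) ∘ just)
      shuffle₁ : ∀ Q G S w → Q * (G * S + w) ≡ G * (Q * S) + Q * w
      shuffle₁ = solve-∀
      shuffle₂ : ∀ H P s E e w x → H * P * s + E * e + (P * w + E * x) ≡ P * (w + H * s) + E * (e + x)
      shuffle₂ = solve-∀

    ∑-copies≤ : ∀ {ts} → All (IsDary d) ts →
      G * (Q * ∑ ts (copies (just D) ∘ just)) ≤ H * P * ∑ ts (λ t → ‖ t ‖ C k) + E * ∑ ts (excess κ)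
    ∑-copies≤ []                 = ≤-trans (≤-reflexive (trans (cong (G *_) (*-zeroʳ Q)) (*-zeroʳ G))) z≤n
    ∑-copies≤ {t ∷ ts} (p ∷ ps) = begin
      G * (Q * (copies (just D) (just t) + ∑ ts (copies (just D) ∘ just)))
        ≡⟨ split₁ G Q (copies (just D) (just t)) _ ⟩
      G * (Q * copies (just D) (just t)) + G * (Q * ∑ ts (copies (just D) ∘ just))
        ≤⟨ +-mono-≤ (copies≤ p) (∑-copies≤ ps) ⟩
      H * P * (‖ t ‖ C k) + E * excess κ t + (H * P * ∑ ts (λ t → ‖ t ‖ C k) + E * ∑ ts (excess κ))
        ≡⟨ split₂ (H * P) (‖ t ‖ C k) E (excess κ t) (∑ ts (λ t → ‖ t ‖ C k)) (∑ ts (excess κ)) ⟩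
      H * P * ∑ (t ∷ ts) (λ t → ‖ t ‖ C k) + E * ∑ (t ∷ ts) (excess κ) ∎
      where
      open ≤-Reasoning
      split₁ : ∀ G Q a b → G * (Q * (a + b)) ≡ G * (Q * a) + G * (Q * b)
      split₁ = solve-∀
      split₂ : ∀ h x E y x′ y′ → h * x + E * y + (h * x′ + E * y′) ≡ h * (x + x′) + E * (y + y′)
      split₂ = solve-∀

-- The constants G and H in terms of M and the numbers m_j.

toList≡tabulate : ∀ {A : Set} {n} (v : Vec A n) → tabulate (Vec.lookup v) ≡ toList v
toList≡tabulate []      = refl
toList≡tabulate (x ∷ v) = cong (x ∷_) (toList≡tabulate v)

∑-tabulate : ∀ {A : Set} {n} (f : Fin n → A) (h : A → ℕ) → ∑ (tabulate f) h ≡ Fin-Sum.sum (h ∘ f)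
∑-tabulate {n = zero}  f h = refl
∑-tabulate {n = suc n} f h = cong (h (f zero) +_) (∑-tabulate (f ∘ suc) h)

product-ones : ∀ {n} (f : Fin n → ℕ) → (∀ i → f i ≡ 1) → product (tabulate f) ≡ 1
product-ones {zero}  f e = refl
product-ones {suc n} f e = cong₂ _*_ (e zero) (product-ones (f ∘ suc) (e ∘ suc))

Any⇒1≤∑ : ∀ {A : Set} {R : A → Set} {f : A → ℕ} {xs} → (∀ x → R x → f x ≡ 1) → Any R xs → 1 ≤ ∑ xs f
Any⇒1≤∑ e (here r)  = ≤-trans (≤-reflexive (sym (e _ r))) (m≤m+n _ _)
Any⇒1≤∑ e (there a) = ≤-trans (Any⇒1≤∑ e a) (m≤n+m _ _)

-- Completeness is applied to π⁻¹, so that the class of a representative σ is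
-- counted by the permanent with rows D_i and columns D_(σ i).
d!≤∣M∣*Φ : ∀ d D M → IsCompleteSetOfRepresentatives d D M → d ! ≤ length M * Iso.Φ (toList (branches d D))
d!≤∣M∣*Φ d D M reps = begin
  d !
    ≤⟨ !≤∑-per Iso.δ M (λ _ → 1) (branch d D) (λ σ i → branch d D (σ ⟨$⟩ʳ i)) (λ π →
         Any⇒1≤∑ (λ σ same → trans (*-identityˡ _) (product-ones _ λ i →
             ⟦⟧-true (branch d D i ≅ᴹ? branch d D (σ ⟨$⟩ʳ (π ⟨$⟩ʳ i)))
               (subst (λ j → branch d D j ≅ᴹ branch d D (σ ⟨$⟩ʳ (π ⟨$⟩ʳ i))) (Perm.inverseˡ π) (same (π ⟨$⟩ʳ i)))))
           (IsCompleteSetOfRepresentatives.complete reps (Perm.flip π))) ⟩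
  ∑ M (λ σ → 1 * per Iso.δ (tabulate (branch d D)) (tabulate λ i → branch d D (σ ⟨$⟩ʳ i)))
    ≡⟨ ∑-cong (λ σ → trans (*-identityˡ _) (trans
         (Iso.per-matched (tabulate (branch d D)) _ (matched σ))
         (cong Iso.Φ (toList≡tabulate (branches d D))))) M ⟩
  ∑ M (λ _ → Iso.Φ (toList (branches d D)))
    ≡⟨ ∑-const _ M ⟩
  length M * Iso.Φ (toList (branches d D)) ∎
  where
  open ≤-Reasoning
  matched : ∀ σ x → Iso.mult x (tabulate (branch d D)) ≡ Iso.mult x (tabulate λ i → branch d D (σ ⟨$⟩ʳ i))
  matched σ x = trans (∑-tabulate (branch d D) (Iso.δ x)) (trans
    (Fin-Sum.sum-permute (Iso.δ x ∘ branch d D) σ) (sym (∑-tabulate (λ i → branch d D (σ ⟨$⟩ʳ i)) (Iso.δ x))))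

∑-mono-lookup : ∀ {A : Set} {n} {f g : A → ℕ} (v : Vec A n) →
                (∀ i → f (Vec.lookup v i) ≤ g (Vec.lookup v i)) → ∑ (toList v) f ≤ ∑ (toList v) g
∑-mono-lookup []      le = z≤n
∑-mono-lookup (x ∷ v) le = +-mono-≤ (le zero) (∑-mono-lookup v (le ∘ suc))

-- Gives H ≤ G, which makes the constant H/G at most 1.
Size-Φ≤Iso-Φ : ∀ {n} (v : Vec Tree₀ n) →
               (∀ i j → ‖ Vec.lookup v i ‖₀ ≡ ‖ Vec.lookup v j ‖₀ → Vec.lookup v i ≅ᴹ Vec.lookup v j) →
               Size.Φ (toList v) ≤ Iso.Φ (toList v)
Size-Φ≤Iso-Φ []      h = ≤-refl
Size-Φ≤Iso-Φ (B ∷ v) h = *-mono-≤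
  (∑-mono-lookup {f = Size.δ B} {g = Iso.δ B} (B ∷ v) λ i → ⟦⟧-mono (‖ B ‖₀ ≟ _) (B ≅ᴹ? _) (h zero i))
  (Size-Φ≤Iso-Φ v (λ i j → h (suc i) (suc j)))

count-∷ : ∀ {A : Set} {R : A → Set} (R? : ∀ x → Dec (R x)) {n} x (v : Vec A n) →
          Vec.count R? (x ∷ v) ≡ ⟦ R? x ⟧ + Vec.count R? v
count-∷ R? x v with R? x
... | yes _ = refl
... | no  _ = refl

countSize : ∀ {n} → ℕ → Vec Tree₀ n → ℕ
countSize j = Vec.count (λ B → ‖ B ‖₀ ≟ j)

countSize≡mult : ∀ {n} B (v : Vec Tree₀ n) → countSize ‖ B ‖₀ v ≡ Size.mult B (toList v)
countSize≡mult B []       = refl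
countSize≡mult B (B′ ∷ v) = trans (count-∷ (λ B″ → ‖ B″ ‖₀ ≟ ‖ B ‖₀) B′ v)
  (cong₂ _+_ (⟦⟧-cong (‖ B′ ‖₀ ≟ ‖ B ‖₀) (‖ B ‖₀ ≟ ‖ B′ ‖₀) sym sym) (countSize≡mult B v))

-- Prepending `B` raises one count from x to x + 1 and so multiplies its factorial by x + 1, once
-- for each occurrence of that size in `js`. For a range containing the size the exponent is 1.
countSize!-∷ : ∀ {n} B (v : Vec Tree₀ n) js →
  product (List.map (λ j → countSize j (B ∷ v) !) js) ≡
  suc (countSize ‖ B ‖₀ v) ^ ∑ js (λ j → ⟦ ‖ B ‖₀ ≟ j ⟧) * product (List.map (λ j → countSize j v !) js)
countSize!-∷ B v []       = refl
countSize!-∷ B v (j ∷ js) rewrite count-∷ (λ B′ → ‖ B′ ‖₀ ≟ j) B v with ‖ B ‖₀ ≟ j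
... | yes refl = trans (cong (suc x * x ! *_) (countSize!-∷ B v js)) (*-interchange (suc x) (x !) (suc x ^ e) y)
  where
  x = countSize ‖ B ‖₀ v
  e = ∑ js (λ j → ⟦ ‖ B ‖₀ ≟ j ⟧)
  y = product (List.map (λ j → countSize j v !) js)
... | no  _    = trans (cong (countSize j v ! *_) (countSize!-∷ B v js))
  (m*[n*o]≡n*[m*o] (countSize j v !) (suc (countSize ‖ B ‖₀ v) ^ ∑ js (λ j → ⟦ ‖ B ‖₀ ≟ j ⟧)) _)

∑-applyUpTo-zero : ∀ (f : ℕ → ℕ) n x → (∀ i → x ≢ f i) → ∑ (applyUpTo f n) (λ j → ⟦ x ≟ j ⟧) ≡ 0
∑-applyUpTo-zero f zero    x ne = refl
∑-applyUpTo-zero f (suc n) x ne = cong₂ _+_ (⟦⟧-false (x ≟ f 0) (ne 0)) (∑-applyUpTo-zero (f ∘ suc) n x (ne ∘ suc))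

-- Stated for an injective `f`, since the recursion of `applyUpTo` replaces `f` by `f ∘ suc`.
∑-applyUpTo-one : ∀ (f : ℕ → ℕ) → (∀ {i j} → f i ≡ f j → i ≡ j) → ∀ n i → i < n →
                  ∑ (applyUpTo f n) (λ j → ⟦ f i ≟ j ⟧) ≡ 1
∑-applyUpTo-one f inj (suc n) zero    _         =
  cong₂ _+_ (⟦⟧-true (f 0 ≟ f 0) refl) (∑-applyUpTo-zero (f ∘ suc) n (f 0) (λ i e → 0≢1+n (inj e)))
∑-applyUpTo-one f inj (suc n) (suc i) (s≤s i<n) =
  cong₂ _+_ (⟦⟧-false (f (suc i) ≟ f 0) (λ e → 1+n≢0 (inj e)))
            (∑-applyUpTo-one (f ∘ suc) (suc-injective ∘ inj) n i i<n)

∏countSize! : ∀ {n} (v : Vec Tree₀ n) K → ∑ (toList v) ‖_‖₀ < K →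
              product (List.map (λ j → countSize j v !) (upTo K)) ≡ Size.Φ (toList v)
∏countSize! []      K lt = ones (upTo K)
  where
  ones : (js : List ℕ) → product (List.map (λ _ → 1) js) ≡ 1
  ones []       = refl
  ones (j ∷ js) = trans (+-identityʳ _) (ones js)
∏countSize! (B ∷ v) K lt = begin
  product (List.map (λ j → countSize j (B ∷ v) !) (upTo K))
    ≡⟨ countSize!-∷ B v (upTo K) ⟩
  suc (countSize ‖ B ‖₀ v) ^ ∑ (upTo K) (λ j → ⟦ ‖ B ‖₀ ≟ j ⟧) * product (List.map (λ j → countSize j v !) (upTo K))
    ≡⟨ cong₂ _*_ (cong (suc (countSize ‖ B ‖₀ v) ^_) (∑-applyUpTo-one (λ i → i) (λ e → e) K ‖ B ‖₀ (≤-<-trans (m≤m+n _ _) lt)))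
                 (∏countSize! v K (≤-<-trans (m≤n+m _ _) lt)) ⟩
  suc (countSize ‖ B ‖₀ v) ^ 1 * Size.Φ (toList v)
    ≡⟨ cong (_* Size.Φ (toList v)) (trans (*-identityʳ _) (cong₂ _+_ (sym (Size.δ-refl B)) (countSize≡mult B v))) ⟩
  Size.Φ (toList (B ∷ v)) ∎
  where open ≡-Reasoning

-- Binomial coefficients from below.

-- The identity (k+1) C(n,k+1) = (n-k) C(n,k) without subtraction, by Pascal's rule.
[k+1]*nC[k+1]+k*nCk≡n*nCk : ∀ n k → suc k * (n C suc k) + k * (n C k) ≡ n * (n C k)
[k+1]*nC[k+1]+k*nCk≡n*nCk zero    zero    = refl
[k+1]*nC[k+1]+k*nCk≡n*nCk zero    (suc k) = cong₂ _+_ (*-zeroʳ (suc (suc k))) (*-zeroʳ (suc k))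
[k+1]*nC[k+1]+k*nCk≡n*nCk (suc n) zero    =
  trans (+-identityʳ _) (trans (+-identityʳ _) (trans (nC1≡n (suc n)) (sym (*-identityʳ _))))
[k+1]*nC[k+1]+k*nCk≡n*nCk (suc n) (suc k) = begin
  suc (suc k) * (suc n C suc (suc k)) + suc k * (suc n C suc k)
    ≡⟨ cong₂ (λ x y → suc (suc k) * x + suc k * y) (nCk+nC[k+1]≡[n+1]C[k+1] n (suc k)) (nCk+nC[k+1]≡[n+1]C[k+1] n k) ⟨
  suc (suc k) * (c₁ + c₂) + suc k * (c₀ + c₁)
    ≡⟨ shuffle k c₀ c₁ c₂ ⟩
  suc (suc k) * c₂ + suc k * c₁ + (suc k * c₁ + k * c₀) + (c₀ + c₁)
    ≡⟨ cong₂ (λ x y → x + y + (c₀ + c₁)) ([k+1]*nC[k+1]+k*nCk≡n*nCk n (suc k)) ([k+1]*nC[k+1]+k*nCk≡n*nCk n k) ⟩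
  n * c₁ + n * c₀ + (c₀ + c₁)
    ≡⟨ collect n c₀ c₁ ⟩
  suc n * (c₀ + c₁)
    ≡⟨ cong (suc n *_) (nCk+nC[k+1]≡[n+1]C[k+1] n k) ⟩
  suc n * (suc n C suc k) ∎
  where
  open ≡-Reasoning
  c₀ = n C k
  c₁ = n C suc k
  c₂ = n C suc (suc k)
  shuffle : ∀ k a b c → suc (suc k) * (b + c) + suc k * (a + b) ≡
                        suc (suc k) * c + suc k * b + (suc k * b + k * a) + (a + b)
  shuffle = solve-∀
  collect : ∀ n a b → n * b + n * a + (a + b) ≡ suc n * (a + b)
  collect = solve-∀

-- From n ≤ 2(n-k) follows n C(n,k) ≤ 2(k+1) C(n,k+1), the factor gained in each step.
n^k≤2^k*k!*nCk : ∀ n k → 2 * k ≤ n → n ^ k ≤ 2 ^ k * k ! * (n C k)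
n^k≤2^k*k!*nCk n zero    le = ≤-refl
n^k≤2^k*k!*nCk n (suc k) le = begin
  n * n ^ k                        ≤⟨ *-monoʳ-≤ n (n^k≤2^k*k!*nCk n k 2k≤n) ⟩
  n * (2 ^ k * k ! * (n C k))      ≡⟨ m*[n*o]≡n*[m*o] n (2 ^ k * k !) _ ⟩
  2 ^ k * k ! * (n * (n C k))      ≤⟨ *-monoʳ-≤ (2 ^ k * k !) step ⟩
  2 ^ k * k ! * (2 * (suc k * (n C suc k))) ≡⟨ shuffle (2 ^ k) (k !) (suc k) (n C suc k) ⟩
  2 * 2 ^ k * (suc k * k !) * (n C suc k)   ∎
  where
  open ≤-Reasoning
  shuffle : ∀ x y s c → x * y * (2 * (s * c)) ≡ 2 * x * (s * y) * c
  shuffle = solve-∀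
  2k≤n : 2 * k ≤ n
  2k≤n = ≤-trans (*-monoʳ-≤ 2 (n≤1+n k)) le
  double : ∀ a → a + a ≡ 2 * a
  double = solve-∀
  step : n * (n C k) ≤ 2 * (suc k * (n C suc k))
  step = +-cancelʳ-≤ (n * (n C k)) _ _ (begin
    n * (n C k) + n * (n C k)                     ≡⟨ double (n * (n C k)) ⟩
    2 * (n * (n C k))                             ≡⟨ cong (2 *_) ([k+1]*nC[k+1]+k*nCk≡n*nCk n k) ⟨
    2 * (suc k * (n C suc k) + k * (n C k))       ≡⟨ *-distribˡ-+ 2 (suc k * (n C suc k)) _ ⟩
    2 * (suc k * (n C suc k)) + 2 * (k * (n C k))
      ≡⟨ cong (2 * (suc k * (n C suc k)) +_) (*-assoc 2 k (n C k)) ⟨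
    2 * (suc k * (n C suc k)) + 2 * k * (n C k)
      ≤⟨ +-monoʳ-≤ (2 * (suc k * (n C suc k))) (*-monoˡ-≤ (n C k) 2k≤n) ⟩
    2 * (suc k * (n C suc k)) + n * (n C k)       ∎)

-- Positive rationals as fractions of natural numbers.

infix 8 _∕_

-- p ∕ s is the fraction p / (s + 1).
_∕_ : ℕ → ℕ → ℚ
p ∕ s = ℤ.+ p ℚ./ suc s

∕-<⁻¹ : ∀ p s p′ s′ → p ∕ s ℚ.< p′ ∕ s′ → p * suc s′ < p′ * suc s
∕-<⁻¹ p s p′ s′ lt with ℚᵘ.<-respˡ-≃ (ℚ.toℚᵘ-fromℚᵘ (ℚᵘ.mkℚᵘ (ℤ.+ p) s))
                        (ℚᵘ.<-respʳ-≃ (ℚ.toℚᵘ-fromℚᵘ (ℚᵘ.mkℚᵘ (ℤ.+ p′) s′)) (ℚ.toℚᵘ-mono-< lt))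
... | ℚᵘ.*<* lt′ = ℤ.drop‿+<+ (subst₂ ℤ._<_ (sym (ℤ.pos-* p (suc s′))) (sym (ℤ.pos-* p′ (suc s))) lt′)

∕-< : ∀ p s p′ s′ → p * suc s′ < p′ * suc s → p ∕ s ℚ.< p′ ∕ s′
∕-< p s p′ s′ lt = ℚ.toℚᵘ-cancel-<
  (ℚᵘ.<-respˡ-≃ (ℚᵘ.≃-sym (ℚ.toℚᵘ-fromℚᵘ (ℚᵘ.mkℚᵘ (ℤ.+ p) s)))
  (ℚᵘ.<-respʳ-≃ (ℚᵘ.≃-sym (ℚ.toℚᵘ-fromℚᵘ (ℚᵘ.mkℚᵘ (ℤ.+ p′) s′)))
    (ℚᵘ.*<* (subst₂ ℤ._<_ (ℤ.pos-* p (suc s′)) (ℤ.pos-* p′ (suc s)) (ℤ.+<+ lt)))))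

-- The index on the right is (s+1)(s′+1) - 1, in the form to which `suc s * suc s′` reduces.
∕-* : ∀ p s p′ s′ → p ∕ s ℚ.* p′ ∕ s′ ≡ (p * p′) ∕ (s′ + s * suc s′)
∕-* p s p′ s′ = ℚ.toℚᵘ-injective (ℚᵘ.≃-trans (ℚ.toℚᵘ-homo-* (p ∕ s) (p′ ∕ s′)) (ℚᵘ.≃-trans
  (ℚᵘ.*-cong (ℚ.toℚᵘ-fromℚᵘ (ℚᵘ.mkℚᵘ (ℤ.+ p) s)) (ℚ.toℚᵘ-fromℚᵘ (ℚᵘ.mkℚᵘ (ℤ.+ p′) s′)))
  (ℚᵘ.≃-trans (ℚᵘ.≃-reflexive (cong (λ z → ℚᵘ.mkℚᵘ z (s′ + s * suc s′)) (sym (ℤ.pos-* p p′))))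
    (ℚᵘ.≃-sym (ℚ.toℚᵘ-fromℚᵘ (ℚᵘ.mkℚᵘ (ℤ.+ (p * p′)) (s′ + s * suc s′)))))))

-- A view: the rationals found in cuts are positive, and matching on it lets inequalities between
-- them be cross-multiplied in `ℕ`.
data IsFraction : ℚ → Set where
  fraction : ∀ p s → IsFraction (p ∕ s)

positive⇒fraction : ∀ {q} → 0ℚ ℚ.< q → IsFraction q
positive⇒fraction {q@(ℚ.mkℚ (ℤ.+ p) s _)} lt = subst IsFraction (ℚ.fromℚᵘ-toℚᵘ q) (fraction p s)
positive⇒fraction {q@(ℚ.mkℚ ℤ.-[1+ p ] s _)} lt with ℚ.positive {q} lt
... | ()

÷≺⇒< : ∀ a {b} p s → 0 < b → (a ÷ b) ≺ (p ∕ s) → a * suc s < p * b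
÷≺⇒< a {suc b} p s _ lt = ∕-<⁻¹ a b p s lt

<⇒÷≺ : ∀ {a} b {p s} → a * suc s < p * b → (a ÷ b) ≺ (p ∕ s)
<⇒÷≺ {a} zero    {p} {s} lt = contradiction (subst (a * suc s <_) (*-zeroʳ p) lt) (λ ())
<⇒÷≺ {a} (suc b) {p} {s} lt = ∕-< a b p s lt

-- Trees with one leaf.

-- Witnesses that arbitrarily large d-ary trees exist: over empty families the suprema in `I` would
-- be 0, and a leaf would not have inducibility 1.
caterpillar : ℕ → Tree
caterpillar zero    = node []
caterpillar (suc n) = node (node [] ∷ caterpillar n ∷ [])

caterpillar-dary : ∀ {d} → 2 ≤ d → ∀ n → IsDary d (caterpillar n)
caterpillar-dary 2≤d zero    = leaf
caterpillar-dary 2≤d (suc n) = internal ≤-refl 2≤d (leaf ∷ caterpillar-dary 2≤d n ∷ [])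

‖caterpillar‖ : ∀ n → ‖ caterpillar n ‖ ≡ suc n
‖caterpillar‖ zero    = refl
‖caterpillar‖ (suc n) = cong suc (trans (+-identityʳ _) (‖caterpillar‖ n))

2≤‖∷∷‖* : ∀ t u ts → 2 ≤ ‖ t ∷ u ∷ ts ‖*
2≤‖∷∷‖* t u ts = +-mono-≤ (‖t‖>0 t) (≤-trans (‖t‖>0 u) (m≤m+n _ _))

mutual
  -- `join` keeps a vertex only above two nonempty trees, hence above at least two leaves.
  induced-leaf : ∀ T S → ‖ induced T S ‖₀ ≡ 1 → induced T S ≡ just (node [])
  induced-leaf (node [])       (inside  ∷ []) e = refl
  induced-leaf (node [])       (outside ∷ []) ()
  induced-leaf (node (t ∷ ts)) S              e with induced* (t ∷ ts) S | induced*-leaf (t ∷ ts) S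
  ... | []         | _     = contradiction e (λ ())
  ... | u ∷ []     | h ∷ _ = cong just (h e)
  ... | u ∷ v ∷ us | _     = contradiction e (λ e → <⇒≢ (2≤‖∷∷‖* u v us) (sym e))

  induced*-leaf : ∀ ts S → All (λ u → ‖ u ‖ ≡ 1 → u ≡ node []) (induced* ts S)
  induced*-leaf []       S = []
  induced*-leaf (t ∷ ts) S with induced t (take ‖ t ‖ S) | induced-leaf t (take ‖ t ‖ S)
  ... | nothing | _ = induced*-leaf ts (drop ‖ t ‖ S)
  ... | just u  | h = (λ e → just-injective (h e)) ∷ induced*-leaf ts (drop ‖ t ‖ S)

dary-leaf : ∀ {d B} → IsDary d B → ‖ B ‖ ≤ 1 → B ≡ node []
dary-leaf leaf le = refl
dary-leaf (internal {_ ∷ []} (s≤s ()) _ _) le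
dary-leaf (internal {t ∷ u ∷ ts} _ _ _) le = contradiction (≤-trans (2≤‖∷∷‖* t u ts) le) (λ { (s≤s ()) })

c-leaf : ∀ T → c (node []) T ≡ ‖ T ‖
c-leaf T = begin
  c (node []) T                                        ≡⟨ c≡copies (node []) T ⟩
  copies (just (node [])) (just T)                     ≡⟨ ∑-map (induced T) _ (subsets ‖ T ‖) ⟩
  ∑ (subsets ‖ T ‖) (λ S → ⟦ just (node []) ≅ᴹ? induced T S ⟧)
    ≡⟨ ∑-cong (λ S → ⟦⟧-cong (just (node []) ≅ᴹ? induced T S) (1 ≟ ‖ induced T S ‖₀) ≅ᴹ⇒‖‖₀≡
         (λ e → subst (just (node []) ≅ᴹ_) (sym (induced-leaf T S (sym e))) (Pointwise.just ≅-refl))) (subsets ‖ T ‖) ⟩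
  ∑ (subsets ‖ T ‖) (λ S → ⟦ 1 ≟ ‖ induced T S ‖₀ ⟧)   ≡⟨ ∑-map (induced T) _ (subsets ‖ T ‖) ⟨
  ∑ (inducedTrees (just T)) (λ u → ⟦ 1 ≟ ‖ u ‖₀ ⟧)     ≡⟨ ∑-inducedTrees-‖‖ (just T) 1 ⟩
  ‖ T ‖ C 1                                            ≡⟨ nC1≡n ‖ T ‖ ⟩
  ‖ T ‖                                                ∎
  where open ≡-Reasoning

-- From inducibilities to estimates.

module _ {d : ℕ} where

  estimate-by-total : ∀ B {p q} → q ≤ p → Estimate d B p q
  estimate-by-total B {p} {q} q≤p = 0 , λ T _ m _ →
    ≤-trans (*-monoʳ-≤ (m * m) (*-mono-≤ q≤p (copies≤C B T))) (m≤m+n _ _)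

  I≺⇒γ≺ : ∀ B a → I d (just B) ≺ a → ∃ λ N → ∀ T → IsDary d T → N ≤ ‖ T ‖ → γ B T ≺ a
  I≺⇒γ≺ B a (N , r , _ , r<a , h) = N , λ T dT le →
    let r′ , _ , r′<r , h′ = h (‖ T ‖ , le)
    in upward (γ B T) (h′ (T , dT , refl)) (ℚ.<-trans r′<r r<a)

  -- A leaf has density 1 in every nonempty tree; one large caterpillar transfers this to any
  -- rational above the limsup.
  leaf-estimate : 2 ≤ d → ∀ p s → I d (just (node [])) ≺ (p ∕ s) → suc s ≤ p
  leaf-estimate 2≤d p s I≺ = <⇒≤ (*-cancelˡ-< (suc N) (suc s) p (subst (suc N * suc s <_) (*-comm p (suc N)) (÷≺⇒< (suc N) p s (s≤s z≤n) γ≺)))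
    where
    N = proj₁ (I≺⇒γ≺ (node []) (p ∕ s) I≺)
    T = caterpillar N
    γ≺ : (suc N ÷ suc N) ≺ (p ∕ s)
    γ≺ = subst₂ (λ x y → (x ÷ y) ≺ (p ∕ s)) (trans (c-leaf T) (‖caterpillar‖ N)) (trans (nC1≡n ‖ T ‖) (‖caterpillar‖ N))
           (proj₂ (I≺⇒γ≺ (node []) (p ∕ s) I≺) T (caterpillar-dary 2≤d N) (≤-trans (n≤1+n N) (≤-reflexive (sym (‖caterpillar‖ N)))))

  -- Beyond `N` leaves the density is below the fraction outright. Up to `N` there are at most
  -- `N ^ ‖ B ‖` copies, and ‖B‖ ≥ 2 gives m² ≤ m^‖B‖, which covers them by the error.
  large-estimate : ∀ B p s → 2 ≤ ‖ B ‖ → I d (just B) ≺ (p ∕ s) → Estimate d (just B) p (suc s)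
  large-estimate B p s 2≤ I≺ = suc s * N ^ ‖ B ‖ , bound
    where
    open ≤-Reasoning
    N = proj₁ (I≺⇒γ≺ B (p ∕ s) I≺)
    small : ∀ T m → 1 ≤ m → ‖ T ‖₀ ≤ N →
            m * m * (suc s * copies (just B) T) ≤ m * m * (p * sizeC (just B) T) + suc s * N ^ ‖ B ‖ * m ^ ‖ B ‖
    small T m 1≤m le = begin
      m * m * (suc s * copies (just B) T)
        ≤⟨ *-monoʳ-≤ (m * m) (*-monoʳ-≤ (suc s) (≤-trans (copies≤C (just B) T) (≤-trans (nCk≤n^k ‖ T ‖₀ ‖ B ‖) (^-monoˡ-≤ ‖ B ‖ le)))) ⟩
      m * m * (suc s * N ^ ‖ B ‖)
        ≡⟨ *-comm (m * m) _ ⟩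
      suc s * N ^ ‖ B ‖ * (m * m)
        ≡⟨ cong (λ z → suc s * N ^ ‖ B ‖ * (m * z)) (*-identityʳ m) ⟨
      suc s * N ^ ‖ B ‖ * m ^ 2
        ≤⟨ *-monoʳ-≤ (suc s * N ^ ‖ B ‖) (^-monoʳ-≤ m {{>-nonZero 1≤m}} 2≤) ⟩
      suc s * N ^ ‖ B ‖ * m ^ ‖ B ‖
        ≤⟨ m≤n+m _ _ ⟩
      m * m * (p * sizeC (just B) T) + suc s * N ^ ‖ B ‖ * m ^ ‖ B ‖ ∎
    ratio : ∀ T → (c B T ÷ (‖ T ‖ C ‖ B ‖)) ≺ (p ∕ s) → suc s * copies (just B) (just T) ≤ p * (‖ T ‖ C ‖ B ‖)
    ratio T γ≺ rewrite sym (c≡copies B T) with ‖ T ‖ C ‖ B ‖ in eq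
    -- By the convention `a ÷ 0 = 0` the density is uninformative here, but without sets of this
    -- size there are no copies either.
    ... | zero  rewrite n≤0⇒n≡0 (subst₂ _≤_ (sym (c≡copies B T)) eq (copies≤C (just B) (just T))) =
      ≤-trans (≤-reflexive (*-zeroʳ (suc s))) z≤n
    ... | suc C = ≤-trans (≤-reflexive (*-comm (suc s) (c B T))) (<⇒≤ (÷≺⇒< (c B T) p s (s≤s z≤n) γ≺))
    bound : ∀ T → Maybe.All (IsDary d) T → ∀ m → 1 ≤ m →
            m * m * (suc s * copies (just B) T) ≤ m * m * (p * sizeC (just B) T) + suc s * N ^ ‖ B ‖ * m ^ ‖ B ‖
    bound nothing  _         m 1≤m = small nothing m 1≤m z≤n
    bound (just T) (just dT) m 1≤m with ≤-total ‖ T ‖ N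
    ... | inj₁ le = small (just T) m 1≤m le
    ... | inj₂ ge = ≤-trans (*-monoʳ-≤ (m * m) (ratio T (proj₂ (I≺⇒γ≺ B (p ∕ s) I≺) T dT ge))) (m≤m+n _ _)

  estimate : 2 ≤ d → ∀ B p s → Maybe.All (IsDary d) B → I d B ≺ (p ∕ s) → Estimate d B p (suc s)
  estimate 2≤d nothing  p s nothing   1<a = estimate-by-total nothing
    (<⇒≤ (subst₂ _<_ (*-identityˡ (suc s)) (*-identityʳ p) (∕-<⁻¹ 1 0 p s 1<a)))
  estimate 2≤d (just B) p s (just dB) I≺  with ‖ B ‖ ≤? 1
  ... | no  k≰1 = large-estimate B p s (≰⇒> k≰1) I≺
  ... | yes k≤1 with refl ← dary-leaf dB k≤1 = estimate-by-total (just B) (leaf-estimate 2≤d p s I≺)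

  -- Unfolding the cut of the product yields a rational above each factor; P/Q is their product and
  -- is at most x/(y+1).
  estimates : 2 ≤ d → ∀ {n} (Bs : Vec Tree₀ n) x y → All (Maybe.All (IsDary d)) (toList Bs) →
              ∏ (map (I d) Bs) ≺ (x ∕ y) →
              ∃ λ P → ∃ λ Q → Estimates d (toList Bs) P Q × 0 < Q × P * suc y ≤ x * Q
  estimates 2≤d []       x y []       1<b =
    1 , 1 , [] , s≤s z≤n , <⇒≤ (∕-<⁻¹ 1 0 x y 1<b)
  estimates 2≤d (B ∷ Bs) x y (dB ∷ dBs) (a , b , I≺ , ∏≺ , ab<)
    with positive⇒fraction (positive (I d B) I≺) | positive⇒fraction (positive (∏ (map (I d) Bs)) ∏≺)
  ... | fraction p s | fraction x′ y′ =
    let P , Q , ests , 0<Q , P≤ = estimates 2≤d Bs x′ y′ dBs ∏≺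
    in p * P , suc s * Q , _∷_ {p = p} {suc s} (estimate 2≤d B p s dB I≺) ests , *-mono-≤ (s≤s {n = s} z≤n) 0<Q ,
       *-cancelʳ-≤ _ _ (suc y′) (begin
         p * P * suc y * suc y′      ≡⟨ shuffle₁ p P (suc y) (suc y′) ⟩
         p * suc y * (P * suc y′)    ≤⟨ *-monoʳ-≤ (p * suc y) P≤ ⟩
         p * suc y * (x′ * Q)        ≡⟨ shuffle₂ p (suc y) x′ Q ⟩
         p * x′ * suc y * Q
           ≤⟨ *-monoˡ-≤ Q (<⇒≤ (∕-<⁻¹ (p * x′) (y′ + s * suc y′) x y (subst (ℚ._< x ∕ y) (∕-* p s x′ y′) ab<))) ⟩
         x * (suc s * suc y′) * Q    ≡⟨ shuffle₃ x (suc s) (suc y′) Q ⟩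
         x * (suc s * Q) * suc y′    ∎)
    where
    open ≤-Reasoning
    shuffle₁ : ∀ p P y y′ → p * P * y * y′ ≡ p * y * (P * y′)
    shuffle₁ = solve-∀
    shuffle₂ : ∀ p y x Q → p * y * (x * Q) ≡ p * x * y * Q
    shuffle₂ = solve-∀
    shuffle₃ : ∀ x s y Q → x * (s * y) * Q ≡ x * (s * Q) * y
    shuffle₃ = solve-∀

-- Passage to the limit.

-- The error E n^(κ+1) is eventually absorbed because n C (κ+2) has order n^(κ+2).
eventually< : ∀ {g h E κ ρ σ} n c → h * σ < ρ * g →
              2 * (2 + κ) + suc (2 ^ (2 + κ) * (2 + κ) ! * (σ * E)) ≤ n →
              g * c ≤ h * (n C (2 + κ)) + E * n ^ suc κ →
              c * σ < ρ * (n C (2 + κ))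
eventually< {g} {h} {E} {κ} {ρ} {σ} n c hσ<ρg le gc≤ = *-cancelʳ-< g _ _ (begin-strict
  c * σ * g                            ≡⟨ shuffle₁ c σ g ⟩
  g * c * σ                            ≤⟨ *-monoˡ-≤ σ gc≤ ⟩
  (h * M + E * n ^ suc κ) * σ          ≡⟨ shuffle₂ h M E (n ^ suc κ) σ ⟩
  -- Since `h * σ < ρ * g` holds between natural numbers, a whole `M` is to spare for the error.
  h * σ * M + σ * E * n ^ suc κ        <⟨ +-monoʳ-< (h * σ * M) small ⟩
  h * σ * M + M                        ≡⟨ +-comm _ M ⟩
  suc (h * σ) * M                      ≤⟨ *-monoˡ-≤ M hσ<ρg ⟩
  ρ * g * M                            ≡⟨ shuffle₃ ρ g M ⟩
  ρ * M * g                            ∎)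
  where
  open ≤-Reasoning
  M = n C (2 + κ)
  W = 2 ^ (2 + κ) * (2 + κ) !
  -- The second summand of the threshold gives this; the first gives n ≥ 2(κ+2), required by the
  -- lower bound on `M`.
  W<n : W * (σ * E) < n
  W<n = ≤-trans (m≤n+m _ (2 * (2 + κ))) le
  shuffle₁ : ∀ c s g → c * s * g ≡ g * c * s
  shuffle₁ = solve-∀
  shuffle₂ : ∀ h M E x s → (h * M + E * x) * s ≡ h * s * M + s * E * x
  shuffle₂ = solve-∀
  shuffle₃ : ∀ r g M → r * g * M ≡ r * M * g
  shuffle₃ = solve-∀
  small : σ * E * n ^ suc κ < M
  small = *-cancelˡ-< W _ _ (begin-strict
    W * (σ * E * n ^ suc κ) ≡⟨ *-assoc W (σ * E) _ ⟨
    W * (σ * E) * n ^ suc κ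
      <⟨ *-monoˡ-< (n ^ suc κ) {{m^n≢0 n (suc κ) {{>-nonZero (≤-<-trans z≤n W<n)}}}} W<n ⟩
    n * n ^ suc κ           ≤⟨ n^k≤2^k*k!*nCk n (2 + κ) (≤-trans (m≤m+n _ _) le) ⟩
    W * M                   ∎)

2≤length⇒2≤‖‖* : ∀ ts → 2 ≤ length ts → 2 ≤ ‖ ts ‖*
2≤length⇒2≤‖‖* (t ∷ u ∷ ts) _        = 2≤‖∷∷‖* t u ts
2≤length⇒2≤‖‖* (_ ∷ [])     (s≤s ())

All-padded-dary : ∀ {d ts} → All (IsDary d) ts → ∀ e → All (Maybe.All (IsDary d)) (padded e ts)
All-padded-dary ps       zero    = []
All-padded-dary []       (suc e) = nothing ∷ All-padded-dary [] e
All-padded-dary (p ∷ ps) (suc e) = just p ∷ All-padded-dary ps e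

module _ {d : ℕ} (2≤d : 2 ≤ d) (ds : List Tree) (2≤ds : 2 ≤ length ds) (ds≤d : length ds ≤ d)
         (dary : All (IsDary d) ds) {p s : ℕ}
         (Φ≤ : Size.Φ (padded d ds) * suc s ≤ p * Iso.Φ (padded d ds)) where

  γ≺ : ∀ x y ρ σ → ∏ (map (I d) (pad d ds)) ≺ (x ∕ y) → p ∕ s ℚ.* x ∕ y ℚ.< ρ ∕ σ →
       ∃ λ N → ∀ T → IsDary d T → N ≤ ‖ T ‖ → γ (node ds) T ≺ (ρ ∕ σ)
  γ≺ x y ρ σ ∏≺ ab<ρ with estimates 2≤d (pad d ds) x y (All-padded-dary dary d) ∏≺
  ... | P , Q , ests , 0<Q , P≤ =
    2 * (2 + κ) + suc (2 ^ (2 + κ) * (2 + κ) ! * (suc σ * E)) ,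
    λ T dT le → <⇒÷≺ (‖ T ‖ C ‖ node ds ‖) {ρ} {σ} (begin-strict
      c (node ds) T * suc σ
        <⟨ eventually< {G * Q} {H * P} {E} {κ} {ρ} {suc σ} ‖ T ‖ (c (node ds) T) h<g le (bound T dT) ⟩
      ρ * (‖ T ‖ C (2 + κ))
        ≡⟨ cong (λ k → ρ * (‖ T ‖ C k)) (trans (‖node‖ {ts = ds} 2≤ds) k≡2+κ) ⟨
      ρ * (‖ T ‖ C ‖ node ds ‖)        ∎)
    where
    open ≤-Reasoning
    κ = ‖ ds ‖* ∸ 2
    k≡2+κ : ‖ ds ‖* ≡ 2 + κ
    k≡2+κ = sym (m+[n∸m]≡n (2≤length⇒2≤‖‖* ds 2≤ds))
    open Recursion ds 2≤ds ds≤d κ k≡2+κ ests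
    0<GQ : 0 < G * Q
    0<GQ = *-mono-≤ (n≢0⇒n>0 (Iso.Φ≢0 (padded d ds))) 0<Q
    h<g : H * P * suc σ < ρ * (G * Q)
    h<g = *-cancelʳ-< (suc s * suc y) _ _ (begin-strict
      H * P * suc σ * (suc s * suc y)      ≡⟨ shuffle₁ H P (suc σ) (suc s) (suc y) ⟩
      H * suc s * (P * suc y) * suc σ      ≤⟨ *-monoˡ-≤ (suc σ) (*-mono-≤ Φ≤ P≤) ⟩
      p * G * (x * Q) * suc σ              ≡⟨ shuffle₂ p G x Q (suc σ) ⟩
      p * x * suc σ * (G * Q)              <⟨ *-monoˡ-< (G * Q) {{>-nonZero 0<GQ}}
                                                (∕-<⁻¹ (p * x) (y + s * suc y) ρ σ (subst (ℚ._< ρ ∕ σ) (∕-* p s x y) ab<ρ)) ⟩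
      ρ * (suc s * suc y) * (G * Q)        ≡⟨ shuffle₃ ρ (suc s * suc y) (G * Q) ⟩
      ρ * (G * Q) * (suc s * suc y)        ∎)
      where
      shuffle₁ : ∀ H P σ s y → H * P * σ * (s * y) ≡ H * s * (P * y) * σ
      shuffle₁ = solve-∀
      shuffle₂ : ∀ p G x Q σ → p * G * (x * Q) * σ ≡ p * x * σ * (G * Q)
      shuffle₂ = solve-∀
      shuffle₃ : ∀ r a b → r * a * b ≡ r * b * a
      shuffle₃ = solve-∀
    bound : ∀ T → IsDary d T → G * Q * c (node ds) T ≤ H * P * (‖ T ‖ C (2 + κ)) + E * ‖ T ‖ ^ suc κ
    bound T dT = begin
      G * Q * c (node ds) T
        ≡⟨ trans (*-assoc G Q _) (cong (λ z → G * (Q * z)) (c≡copies (node ds) T)) ⟩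
      G * (Q * copies (just (node ds)) (just T))
        ≤⟨ copies≤ dT ⟩
      H * P * (‖ T ‖ C ‖ ds ‖*) + E * excess κ T
        ≤⟨ +-mono-≤ (≤-reflexive (cong (λ k → H * P * (‖ T ‖ C k)) k≡2+κ))
             (*-monoʳ-≤ E (*-monoˡ-≤ (‖ T ‖ ^ κ) (m∸n≤m ‖ T ‖ 1))) ⟩
      H * P * (‖ T ‖ C (2 + κ)) + E * ‖ T ‖ ^ suc κ ∎

  I≺ : ∀ b {q} → ∏ (map (I d) (pad d ds)) ≺ b → p ∕ s ℚ.* b ℚ.< q → I d (just (node ds)) ≺ q
  I≺ b ∏≺ ab<q with positive⇒fraction (positive (∏ (map (I d) (pad d ds))) ∏≺)
  ... | fraction x y =
    -- Two intermediate rationals: the nested suprema, over n and over trees with n leaves, each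
    -- demand a strict gap.
    let r  , ab<r  , r<q  = ℚ.<-dense ab<q
        r′ , ab<r′ , r′<r = ℚ.<-dense ab<r
        0<r′              = ℚ.≤-<-trans 0≤ab ab<r′
        N , γ<r′          = eventually (positive⇒fraction 0<r′) ab<r′
    in N , r , ℚ.<-trans 0<r′ r′<r , r<q , λ (n , N≤n) →
       r′ , 0<r′ , r′<r , λ (T , dT , ‖T‖≡n) → γ<r′ T dT (≤-trans N≤n (≤-reflexive (sym ‖T‖≡n)))
    where
    0≤ab : 0ℚ ℚ.≤ p ∕ s ℚ.* x ∕ y
    0≤ab = subst (0ℚ ℚ.≤_) (sym (∕-* p s x y))
      (ℚ.nonNegative⁻¹ ((p * x) ∕ (y + s * suc y)) {{ℚ.normalize-nonNeg (p * x) (suc (y + s * suc y))}})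
    eventually : ∀ {r} → IsFraction r → p ∕ s ℚ.* x ∕ y ℚ.< r →
                 ∃ λ N → ∀ T → IsDary d T → N ≤ ‖ T ‖ → γ (node ds) T ≺ r
    eventually (fraction ρ σ) = γ≺ x y ρ σ ∏≺

corollary5 : (d : ℕ) → 2 ≤ d → (D : Tree) → IsDary d D → 2 ≤ ‖ D ‖ →
    ((M : List (Permutation′ d)) → IsCompleteSetOfRepresentatives d D M →
    I d (just D) ≼ ((length M * ∏m! d D) ÷ (d !)) · ∏ (map (I d) (branches d D)))
    ×
    ((∀ i j → ‖ branch d D i ‖₀ ≡ ‖ branch d D j ‖₀ → branch d D i ≅ᴹ branch d D j) →
    I d (just D) ≼ ∏ (map (I d) (branches d D)))
corollary5 d 2≤d (node ds) leaf (s≤s ())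
corollary5 d 2≤d (node ds) (internal 2≤ds ds≤d dary) 2≤D = general , equal-sizes
  where
  D = node ds
  G = Iso.Φ (padded d ds)

  ∏m!≡ : ∏m! d D ≡ Size.Φ (padded d ds)
  ∏m!≡ = ∏countSize! (pad d ds) (suc ‖ D ‖) (s≤s (≤-reflexive
    (trans (Root.∑-Bs ds 2≤ds ds≤d) (sym (‖node‖ {ts = ds} 2≤ds)))))

  general : (M : List (Permutation′ d)) → IsCompleteSetOfRepresentatives d D M →
    I d (just D) ≼ ((length M * ∏m! d D) ÷ (d !)) · ∏ (map (I d) (branches d D))
  general M reps q (a , b , K≺a , ∏≺b , ab<q)
    with positive⇒fraction (positive ((length M * ∏m! d D) ÷ (d !)) K≺a)
  ... | fraction p s = I≺ 2≤d ds 2≤ds ds≤d dary {p} {s} Φ≤ b ∏≺b ab<q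
    where
    open ≤-Reasoning
    Φ≤ : Size.Φ (padded d ds) * suc s ≤ p * G
    -- Strictness is kept until `length M` is cancelled: a strict inequality between its multiples
    -- excludes the value 0.
    Φ≤ = <⇒≤ (*-cancelˡ-< (length M) _ _ (begin-strict
      length M * (Size.Φ (padded d ds) * suc s)  ≡⟨ *-assoc (length M) _ _ ⟨
      length M * Size.Φ (padded d ds) * suc s    ≡⟨ cong (λ z → length M * z * suc s) ∏m!≡ ⟨
      length M * ∏m! d D * suc s                 <⟨ ÷≺⇒< (length M * ∏m! d D) p s (1≤n! d) K≺a ⟩
      p * d !                                    ≤⟨ *-monoʳ-≤ p (d!≤∣M∣*Φ d D M reps) ⟩
      p * (length M * G)                         ≡⟨ m*[n*o]≡n*[m*o] p (length M) G ⟩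
      length M * (p * G)                         ∎))

  equal-sizes : (∀ i j → ‖ branch d D i ‖₀ ≡ ‖ branch d D j ‖₀ → branch d D i ≅ᴹ branch d D j) →
    I d (just D) ≼ ∏ (map (I d) (branches d D))
  equal-sizes same q ∏≺q =
    -- No constant stands in front, so roundedness supplies the strict gap below `q`; the fraction 1
    -- is given by p = 1, s = 0.
    let b , b<q , ∏≺b = rounded (∏ (map (I d) (branches d D))) ∏≺q
    in I≺ 2≤d ds 2≤ds ds≤d dary {1} {0}
         (≤-trans (≤-reflexive (*-identityʳ _)) (≤-trans (Size-Φ≤Iso-Φ (pad d ds) same) (≤-reflexive (sym (*-identityˡ G)))))
         b ∏≺b (subst (ℚ._< q) (sym (ℚ.*-identityˡ b)) b<q)
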